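{- Let $G_N(x,y,p,q)=\sum_{\pi\in\mathcal D,\ h(\pi)\le N}x^{n(\pi)}y^{h(\pi)}p^{w(\pi)}q^{a(\pi)}$ for $N\ge0$. For $q\neq0$ (that is, as an identity of formal power series in $x$ over a coefficient ring in which $q$ is invertible), $$G_N(x,y,p,q)=\sum_{h=0}^{N}\frac{x^hy^hq^{h^2}\displaystyle\prod_{k=1}^{h}\frac{P_k(q^{2k-3}p^3x,\,p^2/q^2)^2}{P_k(q^{2k-3}px,\,p^2/q^2)^2}}{P_h(q^{2h-3}p^3x,\,p^2/q^2)\;P_{h+1}(q^{2h-1}px,\,p^2/q^2)},$$ where empty products are $1$. On the boundary $q=0$ one has $G_N(x,y,p,0)=1$, and at $p=0$ one has $G_N(x,y,0,q)=1+\sum_{h=1}^{N}(xy)^hq^{h^2}$. The unbounded-height generating function $G(x,y,p,q)=\sum_{\pi\in\mathcal D}x^{n(\pi)}y^{h(\pi)}p^{w(\pi)}q^{a(\pi)}$ is the formal (coefficientwise in $x$) limit of $G_N$ as $N\to\infty$.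
   Context: A Dyck path is a lattice path starting at $(0,0)$, with steps $U=(1,1)$ and $D=(1,-1)$, ending on the line $y=0$ and never visiting a vertex with negative $y$-coordinate; $\mathcal D$ is the set of all Dyck paths (including the empty path). For $\pi\in\mathcal D$ with $2n$ steps, $n(\pi)=n$ is the semi-length; the height $h(\pi)$ is the maximum $y$-coordinate; the proper area $a(\pi)$ is the sum of the starting heights of all steps. Water capacity $w(\pi)$: let $h=h(\pi)$. For each $1\le k\le h$ mark the first up-step $U_k$ of $\pi$ from level $k-1$ to $k$ and the last down-step $D_k$ from level $k$ to $k-1$; they occur in the order $U_1,\dots,U_h,D_h,\dots,D_1$. The portions of $\pi$ strictly between consecutive marked steps are the gaps: for $1\le k<h$ a left gap at level $k$ (between $U_k$ and $U_{k+1}$) and a right gap at level $k$ (between $D_{k+1}$ and $D_k$), and a single top gap at level $h$ (between $U_h$ and $D_h$). A gap at level $k$ starts and ends at height $k$ and never rises above height $k$; reflecting it in the line $y=k$ and translating to the horizontal axis gives a Dyck path of height at most $k$. Then $w(\pi)$ is the sum over all gaps of the proper areas of these reflected Dyck paths (and $w=0$ for the empty path). For $h\ge0$, $P_h(X,Q)=\sum_{m=0}^{\lfloor h/2\rfloor}(-X)^mQ^{m(m-1)}\begin{bmatrix} h-m \\ m \end{bmatrix}_Q$, where $\begin{bmatrix} N \\ m \end{bmatrix}_Q$ is the Gaussian binomial polynomial in $Q$. In particular $P_0=P_1=1$, so the arguments of $P_0,P_1$ are immaterial; each $P_h$ has constant term $1$ in $X$, so the quotients are expanded as formal power series in $x$.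 -}

module Defs where

open import Algebra.Bundles using (CommutativeRing)
open import Algebra.Bundles.Raw using (RawRing)
import Algebra.Definitions.RawSemiring as RawSemiringDefs
open import Data.Fin.Base using (Fin; zero; suc; toℕ)
open import Data.Integer.Base using (ℤ; +_; -[1+_])
open import Data.List.Base
  using (List; []; _∷_; _++_; map; filter; foldr; drop; takeWhile; dropWhile; reverse; upTo)
open import Data.Nat.Base using (ℕ; zero; suc; pred; _∸_; _⊔_; _≤_; ⌊_/2⌋)
import Data.Nat as ℕ
import Data.Nat.ListAction as ℕ
open import Data.Nat.Properties using (_≤?_)
open import Data.Product.Base using (_×_; _,_; proj₁; proj₂; ∃)
open import Data.Product.Properties using (≡-dec)
import Data.Vec.Functional as VF
open import Function.Base using (_∘_)
open import Relation.Binary.Definitions using (DecidableEquality)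
open import Relation.Binary.PropositionalEquality using (_≡_; refl; sym; cong)
open import Relation.Nullary using (Dec; yes; no; ¬?)

------------------------------------------------------------------------
-- Dyck paths

data Step : Set where
  U D : Step

_≟ˢ_ : DecidableEquality Step
U ≟ˢ U = yes refl
U ≟ˢ D = no λ ()
D ≟ˢ U = no λ ()
D ≟ˢ D = yes refl

-- DyckFrom c π: started at height c, the path π never goes below 0 and ends
-- at 0.
data DyckFrom : ℕ → List Step → Set where
  []  : DyckFrom 0 []
  U∷_ : ∀ {c π} → DyckFrom (suc c) π → DyckFrom c (U ∷ π)
  D∷_ : ∀ {c π} → DyckFrom c π → DyckFrom (suc c) (D ∷ π)

Dyck : List Step → Set
Dyck = DyckFrom 0

dyckFrom? : ∀ c π → Dec (DyckFrom c π)
dyckFrom? zero    []      = yes []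
dyckFrom? (suc c) []      = no λ ()
dyckFrom? c       (U ∷ π) with dyckFrom? (suc c) π
... | yes d = yes (U∷ d)
... | no ¬d = no λ { (U∷ d) → ¬d d }
dyckFrom? zero    (D ∷ π) = no λ ()
dyckFrom? (suc c) (D ∷ π) with dyckFrom? c π
... | yes d = yes (D∷ d)
... | no ¬d = no λ { (D∷ d) → ¬d d }

dyck? : ∀ π → Dec (Dyck π)
dyck? = dyckFrom? 0

words : ℕ → List (List Step)
words zero    = [] ∷ []
words (suc m) = map (U ∷_) (words m) ++ map (D ∷_) (words m)

-- The Dyck paths of semi-length n, each listed once.
dyckPaths : ℕ → List (List Step)
dyckPaths n = filter dyck? (words (2 ℕ.* n))

-- Heights are natural numbers; the truncation pred 0 = 0 never occurs along a
-- Dyck path.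
move : Step → ℕ → ℕ
move U = suc
move D = pred

vertices : ℕ → List Step → List ℕ
vertices c []      = c ∷ []
vertices c (s ∷ π) = c ∷ vertices (move s c) π

-- A step together with its starting height.  The up-step from level k - 1 to
-- k is (U , k ∸ 1) and the down-step from level k to k - 1 is (D , k).
LevelStep : Set
LevelStep = Step × ℕ

_≟ˡ_ : DecidableEquality LevelStep
_≟ˡ_ = ≡-dec _≟ˢ_ ℕ._≟_

levelSteps : ℕ → List Step → List LevelStep
levelSteps c []      = []
levelSteps c (s ∷ π) = (s , c) ∷ levelSteps (move s c) π

height : List Step → ℕ
height π = foldr _⊔_ 0 (vertices 0 π)

area : List Step → ℕ
area π = ℕ.sum (map proj₂ (levelSteps 0 π))

------------------------------------------------------------------------
-- Water capacity

beforeFirst afterFirst beforeLast afterLast :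
  LevelStep → List LevelStep → List LevelStep
beforeFirst s   = takeWhile (λ t → ¬? (s ≟ˡ t))
afterFirst  s   = drop 1 ∘ dropWhile (λ t → ¬? (s ≟ˡ t))
beforeLast  s   = reverse ∘ afterFirst s ∘ reverse
afterLast   s   = reverse ∘ beforeFirst s ∘ reverse

-- The marked steps U_k (taken at its first occurrence) and D_k (at its last),
-- for k ≥ 1.
up down : ℕ → LevelStep
up   k = U , pred k
down k = D , k

leftGap rightGap topGap : ℕ → List LevelStep → List LevelStep
leftGap  k = beforeFirst (up (suc k)) ∘ afterFirst (up k)
rightGap k = beforeLast (down k) ∘ afterLast (down (suc k))
topGap   h = beforeLast (down h) ∘ afterFirst (up h)

flip : Step → Step
flip U = D
flip D = U

-- Reflection in the line y = k followed by translation to the axis only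
-- exchanges the two kinds of steps.
reflect : List LevelStep → List Step
reflect = map (flip ∘ proj₁)

gapsUpTo : ℕ → List LevelStep → List (List LevelStep)
gapsUpTo zero    π = []
gapsUpTo (suc h) π =
  topGap (suc h) π ∷
  (map (λ i → leftGap (suc i) π) (upTo h) ++ map (λ i → rightGap (suc i) π) (upTo h))

gaps : List Step → List (List LevelStep)
gaps π = gapsUpTo (height π) (levelSteps 0 π)

water : List Step → ℕ
water π = ℕ.sum (map (area ∘ reflect) (gaps π))

------------------------------------------------------------------------
-- Finite sums and products, Gaussian binomials and the polynomials P_h

module RingNotation {c ℓ} (S : RawRing c ℓ) where
  open RawRing S
  open RawSemiringDefs rawSemiring public using (_^_)
  open RawSemiringDefs rawSemiring using (sum; product)

  sumTo sumFrom1 productFrom1 : ℕ → (ℕ → Carrier) → Carrier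
  sumTo        n f = sum     {suc n} (λ i → f (toℕ i))
  sumFrom1     n f = sum     {n} (λ i → f (suc (toℕ i)))
  productFrom1 n f = product {n} (λ i → f (suc (toℕ i)))

  infixl 6 sumTo sumFrom1
  infixl 7 productFrom1
  syntax sumTo        n (λ i → t) = ∑[0≤ i ≤ n ] t
  syntax sumFrom1     n (λ i → t) = ∑[1≤ i ≤ n ] t
  syntax productFrom1 n (λ i → t) = ∏[1≤ i ≤ n ] t

  -- Integer powers of a unit a with inverse a⁻¹.
  zpow : (a a⁻¹ : Carrier) → ℤ → Carrier
  zpow a a⁻¹ (+ n)    = a ^ n
  zpow a a⁻¹ -[1+ n ] = a⁻¹ ^ suc n

  -- The Gaussian binomial polynomial [n choose m] evaluated at Q, through the
  -- q-Pascal rule.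
  gaussian : ℕ → ℕ → Carrier → Carrier
  gaussian n       zero    Q = 1#
  gaussian zero    (suc m) Q = 0#
  gaussian (suc n) (suc m) Q = gaussian n m Q + Q ^ suc m * gaussian n (suc m) Q

  P : ℕ → Carrier → Carrier → Carrier
  P h X Q = ∑[0≤ m ≤ ⌊ h /2⌋ ]
    ((- X) ^ m * Q ^ (m ℕ.* (m ∸ 1)) * gaussian (h ∸ m) m Q)

------------------------------------------------------------------------
-- Formal power series in x over a commutative ring

module PowerSeries {c ℓ} (R : CommutativeRing c ℓ) where
  open CommutativeRing R public using (Carrier; _≈_)
    renaming (_+_ to _+ᴿ_; _*_ to _*ᴿ_; -_ to -ᴿ_; 0# to 0ᴿ; 1# to 1ᴿ)

  private
    module R = CommutativeRing R
    open RingNotation R.rawRing using (sumTo) renaming (_^_ to _^ᴿ_)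
    open RawSemiringDefs (RawRing.rawSemiring R.rawRing) using () renaming (sum to sumᴿ)

  Series : Set c
  Series = ℕ → Carrier

  infix 4 _≋_
  _≋_ : Series → Series → Set ℓ
  f ≋ g = ∀ n → f n ≈ g n

  const : Carrier → Series
  const a zero    = a
  const a (suc n) = 0ᴿ

  x : Series
  x zero          = 0ᴿ
  x (suc zero)    = 1ᴿ
  x (suc (suc n)) = 0ᴿ

  series : RawRing c ℓ
  series = record
    { Carrier = Series
    ; _≈_     = _≋_
    ; _+_     = λ f g n → f n +ᴿ g n
    ; _*_     = λ f g n → ∑[0≤ i ≤ n ] (f i *ᴿ g (n ∸ i))
    ; -_      = λ f n → -ᴿ f n
    ; 0#      = const 0ᴿ
    ; 1#      = const 1ᴿ
    }

  open RawRing series public using (_+_; _*_; -_; 0#; 1#)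
  open RingNotation series public

  -- (inverseTable f n) lists the coefficients n , n - 1 , … , 0 of f ⁻¹.
  inverseTable : Series → ∀ n → VF.Vector Carrier (suc n)
  inverseTable f zero    = 1ᴿ VF.∷ VF.[]
  inverseTable f (suc n) =
    (-ᴿ sumᴿ (λ i → f (suc (toℕ i)) *ᴿ inverseTable f n i)) VF.∷ inverseTable f n

  -- The inverse of a series with constant term 1 (see *-inverse below); the
  -- constant coefficient of f is otherwise ignored.
  infix 9 _⁻¹
  _⁻¹ : Series → Series
  (f ⁻¹) n = inverseTable f n zero

  infixl 7 _/_
  _/_ : Series → Series → Series
  f / g = f * g ⁻¹

  lookup-inverseTable : ∀ f n i → inverseTable f n i ≡ (f ⁻¹) (n ∸ toℕ i)
  lookup-inverseTable f n       zero    = refl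
  lookup-inverseTable f (suc n) (suc i) = lookup-inverseTable f n i

  *-inverse : ∀ f → f 0 ≈ 1ᴿ → f * f ⁻¹ ≋ 1#
  *-inverse f f₀≈1 zero    =
    R.trans (R.+-identityʳ _) (R.trans (R.*-identityʳ _) f₀≈1)
  *-inverse f f₀≈1 (suc n) = R.trans
    (R.+-cong
      (R.trans (R.*-congʳ f₀≈1) (R.*-identityˡ _))
      (sum-cong-≋ {suc n} λ i →
        R.reflexive (cong (f (suc (toℕ i)) *ᴿ_) (sym (lookup-inverseTable f n i)))))
    (R.-‿inverseˡ _)
    where
    open import Algebra.Properties.Monoid.Sum R.+-monoid using (sum-cong-≋)

  -- Coefficientwise (x-adic) convergence: each coefficient of F N eventually
  -- equals that of f.
  Converges : (ℕ → Series) → Series → Set ℓ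
  Converges F f = ∀ n → ∃ λ N₀ → ∀ N → N₀ ≤ N → F N n ≈ f n

  weight : (y p q : Carrier) → List Step → Carrier
  weight y p q π = y ^ᴿ height π *ᴿ p ^ᴿ water π *ᴿ q ^ᴿ area π

  pathSum : (y p q : Carrier) → List (List Step) → Carrier
  pathSum y p q πs = foldr _+ᴿ_ 0ᴿ (map (weight y p q) πs)

  G≤ : ℕ → (y p q : Carrier) → Series
  G≤ N y p q n = pathSum y p q (filter (λ π → height π ≤? N) (dyckPaths n))

  G : (y p q : Carrier) → Series
  G y p q n = pathSum y p q (dyckPaths n)

{-# OPTIONS --safe #-}
-- Cutting a path at every vertex shows that its water capacity is the sum over its
-- steps of ℓ - c, where c is the starting height and the water level ℓ is the
-- smaller of the maxima before and after.  Along a path ℓ first follows the running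
-- maximum up to h and then the maximum of the remaining suffix down to 0, so on each
-- level a the suffixes from the heights 0 , … , a satisfy a tridiagonal linear
-- system by their first step.  Eliminating the unknowns from height 0 upwards gives
-- continuants S, which for invertible q are the polynomials P, and the ratio
-- f a = S a 1 / S (a + 1) 0 for the gap at level a.  Hence the enumerator T h 0 of
-- the paths of height h satisfies T (h + 1) 0 = x q ^ (2 h + 1) f h f (h + 1) T h 0.
-- This recurrence needs no inverse of q, so it yields all three closed forms.

module Submission where

open import Defs
open import Algebra.Bundles using (CommutativeRing)
open import Data.Integer.Base using (_⊖_)
open import Data.Nat.Base using (ℕ; suc) renaming (_*_ to _*ℕ_)
open import Data.Product.Base using (_×_)
open import Data.Empty using (⊥-elim)
import Data.Integer.Properties as ℤ
open import Data.List.Base using (List; []; _∷_; _++_; map; foldr; filter; length)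
open import Data.List.Properties using (map-∘; filter-all)
open import Data.List.Relation.Unary.All as All using (All; []; _∷_)
import Data.List.Relation.Unary.All.Properties as All
open import Data.Nat.Base using (zero; pred; _∸_; ⌊_/2⌋; _<_; _≤_; z≤n; s≤s) renaming (_+_ to _+ℕ_)
import Data.Nat.Properties as ℕ
open import Data.Product.Base using (_,_; proj₁; proj₂)
open import Function.Base using (_∘_)
open import Relation.Binary.PropositionalEquality as ≡ using (_≡_; _≢_)
import Relation.Binary.Reasoning.Setoid as SetoidReasoning
open import Relation.Nullary using (¬_; Dec; yes; no)

-- The ratio `f a` enumerates one gap at level a; left, right and top gaps share it because they
-- obey the same tridiagonal system and differ only in how the path leaves the level. The 2 h marked
-- steps weigh x ^ h q ^ (h²), so T h 0 is x ^ h q ^ (h²) times f h and all (f a)² with a < h.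
-- Inserting f a = S a 1 / S (a + 1) 0 and S 0 1 = 1, the numerators run over levels below h and the
-- denominators over 1 , ... , h + 1. Completing both to the product over 1 ≤ k ≤ h of (S k 1)² / (S
-- k 0)² leaves exactly the divisor S h 1 * S (h + 1) 0, hence the two unsquared factors of the
-- theorem. The obstacle is that `water` is defined by globally marked steps, while the linear
-- system needs a weight read step by step. `Falling` and `Rising` are grammars of suffixes in which
-- the marked steps have constructors of their own. The weights `ρ` and `σ` follow these grammars
-- and vanish on all other words, so sums over all words of a given length can be split by the first
-- letter.

-- Finite sums, Gaussian binomials and the three-term recurrence of `P`.

module RingNotationProperties {c ℓ} (A : CommutativeRing c ℓ) where
  open CommutativeRing A
  open RingNotation rawRing hiding (_^_)
  open import Algebra.Properties.Semiring.Exp semiring using (_^_; ^-congˡ; ^-homo-*; ^-congʳ)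
  open import Algebra.Properties.Ring ring using (-‿distribʳ-*)
  open import Algebra.Solver.Ring.NaturalCoefficients.Default commutativeSemiring
    using (solve; _:=_; _:+_; _:*_)
  open SetoidReasoning setoid

  sumTo-cong : ∀ n (f g : ℕ → Carrier) → (∀ i → f i ≈ g i) → sumTo n f ≈ sumTo n g
  sumTo-cong zero    f g f≈g = +-congʳ (f≈g 0)
  sumTo-cong (suc n) f g f≈g = +-cong (f≈g 0) (sumTo-cong n _ (λ i → g (suc i)) λ i → f≈g (suc i))

  sumTo-+ : ∀ n f g → sumTo n (λ i → f i + g i) ≈ sumTo n f + sumTo n g
  sumTo-+ zero    f g =
    trans (+-identityʳ _) (sym (+-cong (+-identityʳ _) (+-identityʳ _)))
  sumTo-+ (suc n) f g = begin
    (f 0 + g 0) + sumTo n (λ i → f (suc i) + g (suc i))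
      ≈⟨ +-congˡ (sumTo-+ n (λ i → f (suc i)) (λ i → g (suc i))) ⟩
    (f 0 + g 0) + (sumTo n (λ i → f (suc i)) + sumTo n (λ i → g (suc i)))
      ≈⟨ solve 4 (λ a b u v → (a :+ b) :+ (u :+ v) := (a :+ u) :+ (b :+ v)) refl _ _ _ _ ⟩
    sumTo (suc n) f + sumTo (suc n) g ∎

  *-sumTo : ∀ n a f → a * sumTo n f ≈ sumTo n (λ i → a * f i)
  *-sumTo zero    a f = trans (distribˡ _ _ _) (+-congˡ (zeroʳ a))
  *-sumTo (suc n) a f = trans (distribˡ _ _ _) (+-congˡ (*-sumTo n a (λ i → f (suc i))))

  sumTo-zero : ∀ n f → (∀ i → i ≤ n → f i ≈ 0#) → sumTo n f ≈ 0#
  sumTo-zero zero    f f≈0 = trans (+-identityʳ _) (f≈0 0 z≤n)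
  sumTo-zero (suc n) f f≈0 = trans
    (+-cong (f≈0 0 z≤n) (sumTo-zero n (λ i → f (suc i)) λ i i≤n → f≈0 (suc i) (s≤s i≤n))) (+-identityʳ _)

  sumTo-extend : ∀ {n k} f → n ≤ k → (∀ i → n < i → f i ≈ 0#) → sumTo n f ≈ sumTo k f
  sumTo-extend {zero}  {zero}  f z≤n       _  = refl
  sumTo-extend {zero}  {suc k} f z≤n       f0 =
    +-congˡ (sym (sumTo-zero k (λ i → f (suc i)) λ i _ → f0 (suc i) (s≤s z≤n)))
  sumTo-extend {suc n} {suc k} f (s≤s n≤k) f0 =
    +-congˡ (sumTo-extend (λ i → f (suc i)) n≤k λ i n<i → f0 (suc i) (s≤s n<i))

  sumTo-single : ∀ {n} {f : ℕ → Carrier} k → k ≤ n → (∀ i → i ≢ k → f i ≈ 0#) → sumTo n f ≈ f k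
  sumTo-single {zero}  zero    k≤n       f0 = +-identityʳ _
  sumTo-single {suc n} {f} zero    k≤n       f0 =
    trans (+-congˡ (sumTo-zero n (λ i → f (suc i)) λ i _ → f0 (suc i) λ ())) (+-identityʳ _)
  sumTo-single {suc n} {f} (suc k) (s≤s k≤n) f0 =
    trans (+-cong (f0 0 λ ()) (sumTo-single {n} {λ i → f (suc i)} k k≤n λ i i≢k → f0 (suc i) (i≢k ∘ ℕ.suc-injective)))
      (+-identityˡ _)

  productFrom1-cong : ∀ n (f g : ℕ → Carrier) → (∀ i → f (suc i) ≈ g (suc i)) →
    productFrom1 n f ≈ productFrom1 n g
  productFrom1-cong zero    f g f≈g = refl
  productFrom1-cong (suc n) f g f≈g =
    *-cong (f≈g 0) (productFrom1-cong n (λ i → f (suc i)) (λ i → g (suc i)) λ i → f≈g (suc i))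

  productFrom1-suc : ∀ n f → productFrom1 (suc n) f ≈ productFrom1 n f * f (suc n)
  productFrom1-suc zero    f = *-comm _ _
  productFrom1-suc (suc n) f =
    trans (*-congˡ (productFrom1-suc n (λ i → f (suc i)))) (sym (*-assoc _ _ _))

  zero^suc : ∀ n → 0# ^ suc n ≈ 0#
  zero^suc n = zeroˡ _

  one^ : ∀ n → 1# ^ n ≈ 1#
  one^ zero    = refl
  one^ (suc n) = trans (*-identityˡ _) (one^ n)

  ^-distrib-* : ∀ a b n → (a * b) ^ n ≈ a ^ n * b ^ n
  ^-distrib-* a b zero    = sym (*-identityˡ _)
  ^-distrib-* a b (suc n) = trans (*-congˡ (^-distrib-* a b n))
    (solve 4 (λ a b u v → (a :* b) :* (u :* v) := (a :* u) :* (b :* v)) refl _ _ _ _)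

  gaussian-vanish : ∀ {n m} → n < m → ∀ Q → gaussian n m Q ≈ 0#
  gaussian-vanish {zero}  {suc m} _         Q = refl
  gaussian-vanish {suc n} {suc m} (s≤s n<m) Q = begin
    gaussian n m Q + Q ^ suc m * gaussian n (suc m) Q
      ≈⟨ +-cong (gaussian-vanish n<m Q) (*-congˡ (gaussian-vanish (ℕ.m<n⇒m<1+n n<m) Q)) ⟩
    0# + Q ^ suc m * 0#
      ≈⟨ trans (+-identityˡ _) (zeroʳ _) ⟩
    0# ∎

  term : ℕ → Carrier → Carrier → ℕ → Carrier
  term h X Q m = (- X) ^ m * Q ^ (m *ℕ (m ∸ 1)) * gaussian (h ∸ m) m Q

  P-congˡ : ∀ h {X X′} Q → X ≈ X′ → P h X Q ≈ P h X′ Q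
  P-congˡ h {X} {X′} Q X≈ = sumTo-cong ⌊ h /2⌋ (term h X Q) (term h X′ Q) λ m →
    *-congʳ {gaussian (h ∸ m) m Q} (*-congʳ {Q ^ (m *ℕ (m ∸ 1))} (^-congˡ m (-‿cong X≈)))

  half<⇒<+ : ∀ h m → ⌊ h /2⌋ < m → h < m +ℕ m
  half<⇒<+ zero          (suc m) _         = s≤s z≤n
  half<⇒<+ (suc zero)    (suc m) _         = s≤s (ℕ.≤-trans (s≤s z≤n) (ℕ.≤-reflexive (≡.sym (ℕ.+-suc m m))))
  half<⇒<+ (suc (suc h)) (suc m) (s≤s h<m) =
    s≤s (ℕ.≤-trans (s≤s (half<⇒<+ h m h<m)) (ℕ.≤-reflexive (≡.sym (ℕ.+-suc m m))))

  half<⇒∸< : ∀ h m → ⌊ h /2⌋ < m → h ∸ m < m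
  half<⇒∸< h (suc m) h<m = ℕ.m<n+o⇒m∸n<o h (suc m) (half<⇒<+ h (suc m) h<m)

  -- Past ⌊ h /2⌋ the upper index h ∸ m is smaller than m, so the Gaussian binomial is 0. This lets
  -- the three sums of the recurrence, whose own bounds differ, be compared termwise.
  P-extend : ∀ h X Q {k} → ⌊ h /2⌋ ≤ k → P h X Q ≈ sumTo k (term h X Q)
  P-extend h X Q ≤k = sumTo-extend (term h X Q) ≤k λ m h<m →
    trans (*-congˡ {(- X) ^ m * Q ^ (m *ℕ (m ∸ 1))} (gaussian-vanish (half<⇒∸< h m h<m) Q)) (zeroʳ _)

  pronic-suc : ∀ m → suc m *ℕ m ≡ m +ℕ (m +ℕ m *ℕ (m ∸ 1))
  pronic-suc zero    = ≡.refl
  pronic-suc (suc m) = ≡.cong (suc m +ℕ_) (ℕ.*-suc (suc m) m)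

  -- The q-Pascal rule splits the binomial in two. Its factor Q ^ (m + 1) is absorbed by (- X) ^ (m
  -- + 1), which replaces X by Q X; in the other part (m + 1) m = 2 m + m (m - 1), and Q ^ (2 m) is
  -- absorbed by (- X) ^ m, which replaces X by Q² X.
  term-suc : ∀ h X Q m →
    term (suc (suc h)) X Q (suc m) ≈
    term (suc h) (Q * X) Q (suc m) + (- X) * term h (Q * Q * X) Q m
  term-suc h X Q m = begin
    (- X) ^ suc m * Q ^ (suc m *ℕ m) * gaussian (suc h ∸ m) (suc m) Q
      ≈⟨ *-cong (*-congˡ e₁) (pascal h m) ⟩
    (- X) ^ suc m * (Q ^ m * (Q ^ m * Q ^ n)) * (g + Q ^ suc m * g′)
      ≈⟨ solve 7 (λ x q xm qm qn g g′ →
           (x :* xm) :* (qm :* (qm :* qn)) :* (g :+ (q :* qm) :* g′) :=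
           ((q :* qm) :* (x :* xm)) :* (qm :* (qm :* qn)) :* g′ :+ x :* ((((qm :* qm) :* xm) :* qn) :* g))
           refl (- X) Q ((- X) ^ m) (Q ^ m) (Q ^ n) g g′ ⟩
    (Q ^ suc m * (- X) ^ suc m) * (Q ^ m * (Q ^ m * Q ^ n)) * g′
      + (- X) * (((Q ^ m * Q ^ m) * (- X) ^ m * Q ^ n) * g)
      ≈⟨ +-cong (*-congʳ (*-cong (e₂ (suc m)) (sym e₁))) (*-congˡ (*-congʳ (*-congʳ e₃))) ⟩
    (- (Q * X)) ^ suc m * Q ^ (suc m *ℕ m) * g′
      + (- X) * ((- (Q * Q * X)) ^ m * Q ^ n * g) ∎
    where
    n = m *ℕ (m ∸ 1)
    g  = gaussian (h ∸ m) m Q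
    g′ = gaussian (h ∸ m) (suc m) Q
    e₁ : Q ^ (suc m *ℕ m) ≈ Q ^ m * (Q ^ m * Q ^ n)
    e₁ = trans (^-congʳ Q (pronic-suc m)) (trans (^-homo-* Q m _) (*-congˡ (^-homo-* Q m n)))
    neg : ∀ a → a * (- X) ≈ - (a * X)
    neg a = sym (-‿distribʳ-* a X)
    e₂ : ∀ m → Q ^ m * (- X) ^ m ≈ (- (Q * X)) ^ m
    e₂ m = trans (sym (^-distrib-* Q (- X) m)) (^-congˡ m (neg Q))
    e₃ : (Q ^ m * Q ^ m) * (- X) ^ m ≈ (- (Q * Q * X)) ^ m
    e₃ = trans (*-congʳ (sym (^-distrib-* Q Q m)))
           (trans (sym (^-distrib-* (Q * Q) (- X) m)) (^-congˡ m (neg (Q * Q))))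
    -- For m ≤ h this is the defining clause. For m > h truncated subtraction no longer yields a
    -- successor, but then both sides are 0.
    pascal : ∀ h m → gaussian (suc h ∸ m) (suc m) Q ≈
      gaussian (h ∸ m) m Q + Q ^ suc m * gaussian (h ∸ m) (suc m) Q
    pascal h       zero    = refl
    pascal zero    (suc m) = begin
      gaussian (0 ∸ m) (suc (suc m)) Q
        ≡⟨ ≡.cong (λ k → gaussian k (suc (suc m)) Q) (ℕ.0∸n≡0 m) ⟩
      0#
        ≈⟨ sym (trans (+-identityˡ _) (zeroʳ _)) ⟩
      0# + Q ^ suc (suc m) * 0# ∎
    pascal (suc h) (suc m) with suc h ∸ m in eq
    ... | zero  = begin
      0#                            ≈⟨ sym (trans (+-identityˡ _) (zeroʳ _)) ⟩
      0# + Q ^ suc (suc m) * 0#     ≡⟨ ≡.cong (λ k → gaussian k (suc m) Q + Q ^ suc (suc m) * gaussian k (suc (suc m)) Q)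
                                       (≡.sym (≡.trans (≡.sym (ℕ.pred[m∸n]≡m∸[1+n] (suc h) m)) (≡.cong pred eq))) ⟩
      _ ∎
    ... | suc k = reflexive (≡.cong (λ k → gaussian k (suc m) Q + Q ^ suc (suc m) * gaussian k (suc (suc m)) Q)
                                       (≡.sym (≡.trans (≡.sym (ℕ.pred[m∸n]≡m∸[1+n] (suc h) m)) (≡.cong pred eq))))

  P-suc-suc : ∀ h X Q → P (suc (suc h)) X Q ≈ P (suc h) (Q * X) Q + (- X) * P h (Q * Q * X) Q
  P-suc-suc h X Q = begin
    P (suc (suc h)) X Q
      ≈⟨ P-extend (suc (suc h)) X Q (s≤s (ℕ.⌊n/2⌋≤n h)) ⟩
    term (suc (suc h)) X Q 0 + sumTo h (λ m → term (suc (suc h)) X Q (suc m))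
      ≈⟨ +-congˡ (trans (sumTo-cong h (λ m → term (suc (suc h)) X Q (suc m))
             (λ m → term (suc h) (Q * X) Q (suc m) + (- X) * term h (Q * Q * X) Q m) (term-suc h X Q))
           (sumTo-+ h (λ m → term (suc h) (Q * X) Q (suc m)) (λ m → (- X) * term h (Q * Q * X) Q m))) ⟩
    term (suc h) (Q * X) Q 0 + (sumTo h (λ m → term (suc h) (Q * X) Q (suc m))
      + sumTo h (λ m → (- X) * term h (Q * Q * X) Q m))
      ≈⟨ sym (+-assoc _ _ _) ⟩
    sumTo (suc h) (term (suc h) (Q * X) Q) + sumTo h (λ m → (- X) * term h (Q * Q * X) Q m)
      ≈⟨ +-cong (sym (P-extend (suc h) (Q * X) Q (ℕ.⌊n/2⌋≤n (suc h))))
           (trans (sym (*-sumTo h (- X) (term h (Q * Q * X) Q))) (*-congˡ (sym (P-extend h _ Q (ℕ.⌊n/2⌋≤n h))))) ⟩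
    P (suc h) (Q * X) Q + (- X) * P h (Q * Q * X) Q ∎

-- Transfer matrices of the strips below the water levels

module Strip {c ℓ} (A : CommutativeRing c ℓ) (x p q : CommutativeRing.Carrier A) where
  open CommutativeRing A hiding (zero)
  open RingNotation rawRing using (productFrom1)
  open RingNotationProperties A
  open import Algebra.Properties.Semiring.Exp semiring using (_^_; ^-homo-*; ^-congʳ)
  open import Algebra.Solver.Ring.NaturalCoefficients.Default commutativeSemiring
    using (solve; _:=_; _:+_; _:*_)
  open SetoidReasoning setoid

  -- In the state (c , d) a path is at height c, at depth d below the water
  -- level c + d; a step from there weighs q ^ c * p ^ d.
  α : ℕ → ℕ → Carrier
  α c d = q ^ c * p ^ d

  -- The continuant of the states 0 , … , c - 1 of the strip of water level
  -- c + j - 1.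
  S : ℕ → ℕ → Carrier
  S zero          j = 1#
  S (suc zero)    j = 1#
  S (suc (suc c)) j =
    S (suc c) (suc j) + (- (α (suc c) j * α c (suc j) * x)) * S c (suc (suc j))

  -- One pivot step without division: the equation of v is multiplied by the previous pivot s, so
  -- that the lower neighbour v⁻ turns into a multiple of v. The new pivot s - a a′ x s′ is the next
  -- continuant.
  eliminate : ∀ {a a′ s s′ u v v⁻} → v ≈ a * (u + v⁻) → s * v⁻ ≈ a′ * (s′ * (x * v)) →
    (s + (- (a * a′ * x)) * s′) * v ≈ a * (s * u)
  eliminate {a} {a′} {s} {s′} {u} {v} {v⁻} v≈ sv⁻≈ = begin
    (s + n * s′) * v
      ≈⟨ solve 4 (λ s n s′ v → (s :+ n :* s′) :* v := s :* v :+ n :* (s′ :* v)) refl s n s′ v ⟩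
    s * v + n * (s′ * v)
      ≈⟨ +-congʳ (*-congˡ v≈) ⟩
    s * (a * (u + v⁻)) + n * (s′ * v)
      ≈⟨ +-congʳ (solve 4 (λ s a u v⁻ → s :* (a :* (u :+ v⁻)) := a :* (s :* u) :+ a :* (s :* v⁻))
           refl s a u v⁻) ⟩
    a * (s * u) + a * (s * v⁻) + n * (s′ * v)
      ≈⟨ +-congʳ (+-congˡ (*-congˡ sv⁻≈)) ⟩
    a * (s * u) + a * (a′ * (s′ * (x * v))) + n * (s′ * v)
      ≈⟨ solve 8 (λ a s u a′ s′ x v n →
           a :* (s :* u) :+ a :* (a′ :* (s′ :* (x :* v))) :+ n :* (s′ :* v) :=
           a :* (s :* u) :+ (a :* a′ :* x :+ n) :* (s′ :* v)) refl a s u a′ s′ x v n ⟩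
    a * (s * u) + (a * a′ * x + n) * (s′ * v)
      ≈⟨ +-congˡ (trans (*-congʳ (-‿inverseʳ _)) (zeroˡ _)) ⟩
    a * (s * u) + 0#
      ≈⟨ +-identityʳ _ ⟩
    a * (s * u) ∎
    where n = - (a * a′ * x)

  -- V c d enumerates the suffixes starting in the state (c , d), and B a what
  -- follows the step by which a suffix leaves the strip of level a at its top.
  record FirstStep (V : ℕ → ℕ → Carrier) (B : ℕ → Carrier) : Set ℓ where
    field
      bottom : ∀ d → V 0 (suc d) ≈ α 0 (suc d) * (x * V 1 d)
      inner  : ∀ c d → V (suc c) (suc d) ≈
        α (suc c) (suc d) * (x * V (suc (suc c)) d + V c (suc (suc d)))
      top₀   : V 0 0 ≈ α 0 0 * B 0
      top₊   : ∀ a → V (suc a) 0 ≈ α (suc a) 0 * (B (suc a) + V a 1)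

    -- Gaussian elimination of the tridiagonal system, from the bottom up.
    below : ∀ c d → S (suc c) (suc d) * V c (suc d) ≈
      α c (suc d) * (S c (suc (suc d)) * (x * V (suc c) d))
    below zero    d = trans (*-identityˡ _) (trans (bottom d) (*-congˡ (sym (*-identityˡ _))))
    below (suc c) d = eliminate (inner c d) (below c (suc d))

    -- In the top state the upper neighbour is replaced by the exit `B a`. The factor α a 0 is the
    -- weight of the leaving step, and S a 1 over S (suc a) 0 that of the gap before it.
    top : ∀ a → S (suc a) 0 * V a 0 ≈ α a 0 * (S a 1 * B a)
    top zero    = trans (*-identityˡ _) (trans top₀ (*-congˡ (sym (*-identityˡ _))))
    top (suc a) = eliminate (top₊ a) (below a 0)

  α-top : ∀ a → α a 0 ≈ q ^ a
  α-top a = *-identityʳ _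

  -- T m a enumerates the suffixes starting at height a, their running maximum, with
  -- maximum a + m; for m = 0 the path may have been higher before.
  record Levels (T : ℕ → ℕ → Carrier) : Set ℓ where
    field
      empty : T 0 0 ≈ 1#
      right : ∀ a → S (suc (suc a)) 0 * T 0 (suc a) ≈ α (suc a) 0 * (S (suc a) 1 * T 0 a)
      left  : ∀ m a → S (suc a) 0 * T (suc m) a ≈ α a 0 * (S a 1 * (x * T m (suc a)))

    module _ (i : ℕ → Carrier) (i-inverse : ∀ k → S k 0 ^ 2 * i k ≈ 1#) where

      -- The datum `i` inverts the square of S k 0, because the formula divides by squares and `i`
      -- has to appear in it literally; the inverse of S k 0 itself is recovered from it.
      b⁻¹ : ℕ → Carrier
      b⁻¹ k = S k 0 * i k

      b⁻¹-inverse : ∀ k → S k 0 * b⁻¹ k ≈ 1#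
      b⁻¹-inverse k = trans (trans (sym (*-assoc _ _ _))
        (*-congʳ (*-congˡ (sym (*-identityʳ _))))) (i-inverse k)

      divide : ∀ k {u v} → S k 0 * u ≈ v → u ≈ b⁻¹ k * v
      divide k {u} {v} bu≈v = begin
        u                     ≈⟨ sym (*-identityˡ u) ⟩
        1# * u                ≈⟨ *-congʳ (sym (b⁻¹-inverse k)) ⟩
        S k 0 * b⁻¹ k * u     ≈⟨ solve 3 (λ a b u → a :* b :* u := b :* (a :* u)) refl (S k 0) (b⁻¹ k) u ⟩
        b⁻¹ k * (S k 0 * u)   ≈⟨ *-congˡ bu≈v ⟩
        b⁻¹ k * v ∎

      f : ℕ → Carrier
      f a = S a 1 * b⁻¹ (suc a)

      right′ : ∀ a → T 0 (suc a) ≈ q ^ suc a * (f (suc a) * T 0 a)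
      right′ a = trans (divide (suc (suc a)) (trans (right a) (*-congʳ (α-top (suc a)))))
        (solve 4 (λ b q s t → b :* (q :* (s :* t)) := q :* ((s :* b) :* t)) refl _ _ _ _)

      left′ : ∀ m a → T (suc m) a ≈ q ^ a * (f a * (x * T m (suc a)))
      left′ m a = trans (divide (suc a) (trans (left m a) (*-congʳ (α-top a))))
        (solve 4 (λ b q s t → b :* (q :* (s :* t)) := q :* ((s :* b) :* t)) refl _ _ _ _)

      g : ℕ → Carrier
      g h = x * (q ^ suc h * q ^ h) * (f h * f (suc h))

      -- Raising the maximum from h to h + 1 adds two marked steps, turns the top
      -- gap at level h into two side gaps and adds a top gap.
      raise : ∀ m a → T (suc m) a ≈ g (a +ℕ m) * T m a
      raise zero a = begin
        T 1 a
          ≈⟨ left′ 0 a ⟩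
        q ^ a * (f a * (x * T 0 (suc a)))
          ≈⟨ *-congˡ (*-congˡ (*-congˡ (right′ a))) ⟩
        q ^ a * (f a * (x * (q ^ suc a * (f (suc a) * T 0 a))))
          ≈⟨ solve 6 (λ q₀ f₀ x q₁ f₁ t → q₀ :* (f₀ :* (x :* (q₁ :* (f₁ :* t)))) :=
               x :* (q₁ :* q₀) :* (f₀ :* f₁) :* t) refl (q ^ a) (f a) x (q ^ suc a) (f (suc a)) (T 0 a) ⟩
        g a * T 0 a
          ≡⟨ ≡.cong (λ k → g k * T 0 a) (≡.sym (ℕ.+-identityʳ a)) ⟩
        g (a +ℕ 0) * T 0 a ∎
      raise (suc m) a = begin
        T (suc (suc m)) a
          ≈⟨ left′ (suc m) a ⟩
        q ^ a * (f a * (x * T (suc m) (suc a)))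
          ≈⟨ *-congˡ (*-congˡ (*-congˡ (raise m (suc a)))) ⟩
        q ^ a * (f a * (x * (g (suc (a +ℕ m)) * T m (suc a))))
          ≈⟨ solve 5 (λ q₀ f₀ x g t → q₀ :* (f₀ :* (x :* (g :* t))) := g :* (q₀ :* (f₀ :* (x :* t))))
               refl (q ^ a) (f a) x (g (suc (a +ℕ m))) (T m (suc a)) ⟩
        g (suc (a +ℕ m)) * (q ^ a * (f a * (x * T m (suc a))))
          ≈⟨ *-congˡ (sym (left′ m a)) ⟩
        g (suc (a +ℕ m)) * T (suc m) a
          ≡⟨ ≡.cong (λ k → g k * T (suc m) a) (≡.sym (ℕ.+-suc a m)) ⟩
        g (a +ℕ suc m) * T (suc m) a ∎

      q^square : ∀ h → q ^ (suc h *ℕ suc h) ≈ q ^ suc h * (q ^ h * q ^ (h *ℕ h))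
      q^square h = trans (^-homo-* q (suc h) (h *ℕ suc h))
        (*-congˡ (trans (^-congʳ q (ℕ.*-suc h h)) (^-homo-* q h (h *ℕ h))))

      numerator : ℕ → Carrier
      numerator h = x ^ h * q ^ (h *ℕ h) * productFrom1 h (λ k → S k 1 ^ 2 * i k)

      -- In the recurrence, f h supplies S h 1 * S (suc h) 0, the old denominator, together with a
      -- spare i (suc h). The S (suc h) 1 of f (suc h) and the one of the new denominator form the
      -- square that joins this i as the next factor of the product.
      T*denominator : ∀ h → T h 0 * (S h 1 * S (suc h) 0) ≈ numerator h
      T*denominator zero    = *-cong (trans empty (sym (*-identityˡ _))) (*-identityˡ _)
      T*denominator (suc h) = begin
        T (suc h) 0 * (a₁ * b₂)
          ≈⟨ *-congʳ (raise h 0) ⟩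
        x * (q ^ suc h * q ^ h) * ((a₀ * (b₁ * i₁)) * (a₁ * b⁻¹ (suc (suc h)))) * T h 0 * (a₁ * b₂)
          ≈⟨ solve 10 (λ x q₁ q₀ a₀ b₁ i₁ a₁ b₂′ t b₂ →
               x :* (q₁ :* q₀) :* ((a₀ :* (b₁ :* i₁)) :* (a₁ :* b₂′)) :* t :* (a₁ :* b₂) :=
               (b₂ :* b₂′) :* ((t :* (a₀ :* b₁)) :* (x :* (q₁ :* q₀) :* (a₁ :* a₁ :* i₁)))) refl
               x (q ^ suc h) (q ^ h) a₀ b₁ i₁ a₁ (b⁻¹ (suc (suc h))) (T h 0) b₂ ⟩
        (b₂ * b⁻¹ (suc (suc h))) * ((T h 0 * (a₀ * b₁)) * (x * (q ^ suc h * q ^ h) * (a₁ * a₁ * i₁)))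
          ≈⟨ *-cong (b⁻¹-inverse (suc (suc h))) (*-congʳ (T*denominator h)) ⟩
        1# * (numerator h * (x * (q ^ suc h * q ^ h) * (a₁ * a₁ * i₁)))
          ≈⟨ *-identityˡ _ ⟩
        x ^ h * q ^ (h *ℕ h) * Π * (x * (q ^ suc h * q ^ h) * (a₁ * a₁ * i₁))
          ≈⟨ solve 8 (λ xh qhh Π x q₁ q₀ a₁ i₁ →
               xh :* qhh :* Π :* (x :* (q₁ :* q₀) :* (a₁ :* a₁ :* i₁)) :=
               (x :* xh) :* (q₁ :* (q₀ :* qhh)) :* (Π :* ((a₁ :* a₁) :* i₁))) refl
               (x ^ h) (q ^ (h *ℕ h)) Π x (q ^ suc h) (q ^ h) a₁ i₁ ⟩
        x ^ suc h * (q ^ suc h * (q ^ h * q ^ (h *ℕ h))) * (Π * ((a₁ * a₁) * i₁))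
          ≈⟨ *-cong (*-congˡ (sym (q^square h)))
               (trans (*-congˡ (*-congʳ (*-congˡ (sym (*-identityʳ a₁)))))
                 (sym (productFrom1-suc h (λ k → S k 1 ^ 2 * i k)))) ⟩
        numerator (suc h) ∎
        where
        a₀ = S h 1
        a₁ = S (suc h) 1
        b₁ = S (suc h) 0
        b₂ = S (suc (suc h)) 0
        i₁ = i (suc h)
        Π  = productFrom1 h (λ k → S k 1 ^ 2 * i k)

      T-formula : ∀ h {j} → (S h 1 * S (suc h) 0) * j ≈ 1# → T h 0 ≈ numerator h * j
      T-formula h {j} inv = begin
        T h 0                               ≈⟨ sym (*-identityʳ _) ⟩
        T h 0 * 1#                          ≈⟨ *-congˡ (sym inv) ⟩
        T h 0 * ((S h 1 * S (suc h) 0) * j) ≈⟨ sym (*-assoc _ _ _) ⟩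
        T h 0 * (S h 1 * S (suc h) 0) * j   ≈⟨ *-congʳ (T*denominator h) ⟩
        numerator h * j ∎

-- The continuants `S` as polynomials `P`, for invertible q.

module StripPolynomials {c ℓ} (A : CommutativeRing c ℓ) (x p q q⁻¹ : CommutativeRing.Carrier A)
  (q*q⁻¹≈1 : (A CommutativeRing.≈ CommutativeRing._*_ A q q⁻¹) (CommutativeRing.1# A)) where
  open import Data.Integer.Base using (+_)
  open CommutativeRing A hiding (zero)
  open RingNotation rawRing using (zpow; P)
  open RingNotationProperties A
  open Strip A x p q
  open import Algebra.Properties.Semiring.Exp semiring using (_^_; ^-homo-*; ^-congʳ)
  open import Algebra.Solver.Ring.NaturalCoefficients.Default commutativeSemiring
    using (solve; _:=_; _:*_)
  open SetoidReasoning setoid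

  Q : Carrier
  Q = p ^ 2 * q⁻¹ ^ 2

  z : ℕ → Carrier
  z c = zpow q q⁻¹ (2 *ℕ c ⊖ 3)

  double : ∀ c → 2 *ℕ c ≡ c +ℕ c
  double c = ≡.cong (c +ℕ_) (ℕ.+-identityʳ c)

  exponent : ∀ c → 2 *ℕ suc (suc c) ⊖ 3 ≡ + suc (c +ℕ c)
  exponent c = ≡.trans
    (≡.cong (_⊖ 3) (≡.trans (double (suc (suc c)))
      (≡.cong (λ k → suc (suc k)) (≡.trans (ℕ.+-suc c (suc c)) (≡.cong suc (ℕ.+-suc c c))))))
    (ℤ.⊖-≥ {suc (suc (suc (suc (c +ℕ c))))} (s≤s (s≤s (s≤s z≤n))))

  z-suc-suc : ∀ c → z (suc (suc c)) ≈ q ^ suc (c +ℕ c)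
  z-suc-suc c = reflexive (≡.cong (zpow q q⁻¹) (exponent c))

  cancel : ∀ a → a ≈ q⁻¹ ^ 2 * (q * (q * a))
  cancel a = sym (begin
    q⁻¹ ^ 2 * (q * (q * a))
      ≈⟨ *-congʳ (*-congˡ (*-identityʳ _)) ⟩
    (q⁻¹ * q⁻¹) * (q * (q * a))
      ≈⟨ solve 3 (λ q q⁻¹ a → (q⁻¹ :* q⁻¹) :* (q :* (q :* a)) := (q :* q⁻¹) :* ((q :* q⁻¹) :* a)) refl q q⁻¹ a ⟩
    (q * q⁻¹) * ((q * q⁻¹) * a)
      ≈⟨ *-cong q*q⁻¹≈1 (*-congʳ q*q⁻¹≈1) ⟩
    1# * (1# * a)
      ≈⟨ trans (*-identityˡ _) (*-identityˡ _) ⟩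
    a ∎)

  -- The cases follow the signs of the exponents 2 c - 3 and 2 c - 1: both negative for c = 0, then
  -- -1 and 1, and both positive from c = 2 on, where `zpow` is an ordinary power.
  z-suc : ∀ c → z c ≈ q⁻¹ ^ 2 * z (suc c)
  z-suc zero       = ^-homo-* q⁻¹ 2 1
  z-suc (suc zero) = begin
    q⁻¹ * 1#                        ≈⟨ cancel _ ⟩
    q⁻¹ ^ 2 * (q * (q * (q⁻¹ * 1#))) ≈⟨ *-congˡ (*-congˡ (trans (sym (*-assoc _ _ _)) (trans (*-congʳ q*q⁻¹≈1) (*-identityˡ _)))) ⟩
    q⁻¹ ^ 2 * (q * 1#) ∎
  z-suc (suc (suc c)) = begin
    z (suc (suc c))                    ≈⟨ z-suc-suc c ⟩
    q ^ suc (c +ℕ c)                   ≈⟨ cancel _ ⟩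
    q⁻¹ ^ 2 * q ^ (3 +ℕ (c +ℕ c))      ≈⟨ *-congˡ (^-congʳ q (≡.cong (λ k → suc (suc k)) (≡.sym (ℕ.+-suc c c)))) ⟩
    q⁻¹ ^ 2 * q ^ suc (suc c +ℕ suc c) ≈⟨ *-congˡ (sym (z-suc-suc (suc c))) ⟩
    q⁻¹ ^ 2 * z (suc (suc (suc c))) ∎

  X : ℕ → ℕ → Carrier
  X c j = z c * p ^ suc (2 *ℕ j) * x

  -- Both sides belong to the water level c + j: dropping the top state of a strip lowers the
  -- exponent of q by 2 and raises that of p by 2, so it multiplies the argument by Q = p² / q².
  -- This matches the recursion of `S` with the shifts X, Q X, Q² X in `P-suc-suc`.
  X-suc : ∀ c j → X c (suc j) ≈ Q * X (suc c) j
  X-suc c j = begin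
    z c * p ^ suc (2 *ℕ suc j) * x
      ≈⟨ *-congʳ (*-cong (z-suc c)
           (trans (^-congʳ p (≡.cong suc (ℕ.*-suc 2 j))) (*-congˡ (^-homo-* p 2 (2 *ℕ j))))) ⟩
    q⁻¹ ^ 2 * z (suc c) * (p * (p ^ 2 * p ^ (2 *ℕ j))) * x
      ≈⟨ solve 6 (λ a z p p² pj x → a :* z :* (p :* (p² :* pj)) :* x := (p² :* a) :* (z :* (p :* pj) :* x))
           refl (q⁻¹ ^ 2) (z (suc c)) p (p ^ 2) (p ^ (2 *ℕ j)) x ⟩
    Q * X (suc c) j ∎

  X≈α*α : ∀ c j → α (suc c) j * α c (suc j) * x ≈ X (suc (suc c)) j
  X≈α*α c j = begin
    q ^ suc c * p ^ j * (q ^ c * p ^ suc j) * x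
      ≈⟨ solve 5 (λ q qc p pj x → (q :* qc) :* pj :* (qc :* (p :* pj)) :* x := (q :* (qc :* qc)) :* (p :* (pj :* pj)) :* x)
           refl q (q ^ c) p (p ^ j) x ⟩
    (q * (q ^ c * q ^ c)) * (p * (p ^ j * p ^ j)) * x
      ≈⟨ *-congʳ (*-cong
           (trans (*-congˡ (sym (^-homo-* q c c))) (sym (z-suc-suc c)))
           (*-congˡ (trans (sym (^-homo-* p j j)) (^-congʳ p (≡.sym (double j)))))) ⟩
    X (suc (suc c)) j ∎

  P₀≈1 : 1# * 1# * 1# + 0# ≈ 1#
  P₀≈1 = trans (+-identityʳ _) (trans (*-identityʳ _) (*-identityʳ _))

  S≈P : ∀ c j → S c j ≈ P c (X c j) Q
  S≈P zero          j = sym P₀≈1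
  S≈P (suc zero)    j = sym P₀≈1
  S≈P (suc (suc c)) j = begin
    S (suc c) (suc j) + (- (α (suc c) j * α c (suc j) * x)) * S c (suc (suc j))
      ≈⟨ +-cong (trans (S≈P (suc c) (suc j)) (P-congˡ (suc c) Q (X-suc (suc c) j)))
           (*-cong (-‿cong (X≈α*α c j)) (trans (S≈P c (suc (suc j))) (P-congˡ c Q QQX))) ⟩
    P (suc c) (Q * X (suc (suc c)) j) Q + (- X (suc (suc c)) j) * P c (Q * Q * X (suc (suc c)) j) Q
      ≈⟨ sym (P-suc-suc c (X (suc (suc c)) j) Q) ⟩
    P (suc (suc c)) (X (suc (suc c)) j) Q ∎
    where
    QQX : X c (suc (suc j)) ≈ Q * Q * X (suc (suc c)) j
    QQX = trans (X-suc c (suc j)) (trans (*-congˡ (X-suc (suc c) j)) (sym (*-assoc _ _ _)))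

  S≈P₁ : ∀ k → S k 1 ≈ P k (zpow q q⁻¹ (2 *ℕ k ⊖ 3) * p ^ 3 * x) Q
  S≈P₁ k = S≈P k 1

  S≈P₀ : ∀ k → S k 0 ≈ P k (zpow q q⁻¹ (2 *ℕ k ⊖ 3) * p * x) Q
  S≈P₀ k = trans (S≈P k 0) (P-congˡ k Q (*-congʳ (*-congˡ (*-identityʳ p))))

  S≈P₀-suc : ∀ k → S (suc k) 0 ≈ P (suc k) (zpow q q⁻¹ (2 *ℕ k ⊖ 1) * p * x) Q
  S≈P₀-suc k = trans (S≈P₀ (suc k)) (reflexive (≡.cong
    (λ e → P (suc k) (zpow q q⁻¹ e * p * x) Q)
    (≡.trans (≡.cong (_⊖ 3) (ℕ.*-suc 2 k))
      (≡.trans (ℤ.[1+m]⊖[1+n]≡m⊖n (suc (2 *ℕ k)) 2) (ℤ.[1+m]⊖[1+n]≡m⊖n (2 *ℕ k) 1)))))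

-- Formal power series

module SeriesRing {c ℓ} (R : CommutativeRing c ℓ) where
  open PowerSeries R using (Series; _≋_; const; x; _+_; _*_; -_; 0#; 1#; _^_)
  open CommutativeRing R hiding (_+_; _*_; -_; 0#; 1#; zero; *-cong; distribʳ)
  private module R = CommutativeRing R
  open R using () renaming (_+_ to _⊕_; _*_ to _⊗_)
  open import Algebra.Solver.Ring.NaturalCoefficients.Default R.commutativeSemiring
    using (solve; _:=_; _:+_; _:*_)
  open SetoidReasoning setoid

  -- The coefficient (f * g) (suc n) unfolds by definition to f 0 ⊗ g (suc n) ⊕ (tail f * g) n. The
  -- ring laws below are therefore inductions on n that pass to the tail of the left factor.
  tail : Series → Series
  tail f n = f (suc n)

  0#-coefficient : ∀ n → 0# n ≈ R.0#
  0#-coefficient zero    = refl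
  0#-coefficient (suc n) = refl

  *-cong : ∀ {f f′ g g′} → f ≋ f′ → g ≋ g′ → f * g ≋ f′ * g′
  *-cong f≈ g≈ zero    = +-congʳ (R.*-cong (f≈ 0) (g≈ 0))
  *-cong {f} {f′} {g} {g′} f≈ g≈ (suc n) =
    +-cong (R.*-cong (f≈ 0) (g≈ (suc n))) (*-cong {tail f} {tail f′} {g} {g′} (λ i → f≈ (suc i)) g≈ n)

  *-zeroˡ : ∀ {f} g → f ≋ 0# → f * g ≋ 0#
  *-zeroˡ {f} g f≈0 zero    = trans (+-identityʳ _) (trans (*-congʳ (f≈0 0)) (R.zeroˡ _))
  *-zeroˡ {f} g f≈0 (suc n) = begin
    f 0 ⊗ g (suc n) ⊕ (tail f * g) n
      ≈⟨ +-cong (trans (*-congʳ (f≈0 0)) (R.zeroˡ _))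
           (*-zeroˡ {tail f} g (λ i → trans (f≈0 (suc i)) (sym (0#-coefficient i))) n) ⟩
    R.0# ⊕ 0# n
      ≈⟨ trans (+-identityˡ _) (0#-coefficient n) ⟩
    R.0# ∎

  const-* : ∀ a f n → (const a * f) n ≈ a ⊗ f n
  const-* a f zero    = +-identityʳ _
  const-* a f (suc n) = trans
    (+-congˡ (trans (*-zeroˡ {tail (const a)} f (λ i → sym (0#-coefficient i)) n) (0#-coefficient n)))
    (+-identityʳ _)

  *-identityˡ′ : ∀ f → 1# * f ≋ f
  *-identityˡ′ f n = trans (const-* R.1# f n) (R.*-identityˡ _)

  x*-zero : ∀ f → (x * f) 0 ≈ R.0#
  x*-zero f = trans (+-identityʳ _) (R.zeroˡ _)

  x*-suc : ∀ f n → (x * f) (suc n) ≈ f n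
  x*-suc f n = begin
    R.0# ⊗ f (suc n) ⊕ (tail x * f) n
      ≈⟨ +-cong (R.zeroˡ _) (*-cong {tail x} {1#} {f} {f} tail-x (λ _ → refl) n) ⟩
    R.0# ⊕ (1# * f) n
      ≈⟨ trans (+-identityˡ _) (*-identityˡ′ f n) ⟩
    f n ∎
    where
    tail-x : tail x ≋ 1#
    tail-x zero    = refl
    tail-x (suc n) = refl

  distribʳ : ∀ h f g → (f + g) * h ≋ f * h + g * h
  distribʳ h f g zero    = trans (+-identityʳ _)
    (trans (R.distribʳ _ _ _) (sym (+-cong (+-identityʳ _) (+-identityʳ _))))
  distribʳ h f g (suc n) = begin
    (f 0 ⊕ g 0) ⊗ h (suc n) ⊕ ((tail f + tail g) * h) n
      ≈⟨ +-congˡ (distribʳ h (tail f) (tail g) n) ⟩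
    (f 0 ⊕ g 0) ⊗ h (suc n) ⊕ ((tail f * h) n ⊕ (tail g * h) n)
      ≈⟨ solve 5 (λ a b d u v → (a :+ b) :* d :+ (u :+ v) := (a :* d :+ u) :+ (b :* d :+ v)) refl
           (f 0) (g 0) (h (suc n)) ((tail f * h) n) ((tail g * h) n) ⟩
    (f * h + g * h) (suc n) ∎

  scale-* : ∀ a f g → (λ n → a ⊗ f n) * g ≋ λ n → a ⊗ (f * g) n
  scale-* a f g zero    = trans (+-identityʳ _)
    (trans (*-assoc _ _ _) (*-congˡ (sym (+-identityʳ _))))
  scale-* a f g (suc n) = trans (+-cong (*-assoc _ _ _) (scale-* a (tail f) g n)) (sym (R.distribˡ a _ _))

  *-assoc′ : ∀ f g h → (f * g) * h ≋ f * (g * h)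
  *-assoc′ f g h zero    = trans (+-identityʳ _) (trans (*-congʳ (+-identityʳ _)) (trans (*-assoc _ _ _)
    (sym (trans (+-identityʳ _) (*-congˡ (+-identityʳ _))))))
  *-assoc′ f g h (suc n) = begin
    (f * g) 0 ⊗ h (suc n) ⊕ (((λ i → f 0 ⊗ g (suc i)) + tail f * g) * h) n
      ≈⟨ +-cong (*-congʳ (+-identityʳ _)) (distribʳ h (λ i → f 0 ⊗ g (suc i)) (tail f * g) n) ⟩
    f 0 ⊗ g 0 ⊗ h (suc n) ⊕ (((λ i → f 0 ⊗ g (suc i)) * h) n ⊕ ((tail f * g) * h) n)
      ≈⟨ +-congˡ (+-cong (scale-* (f 0) (tail g) h n) (*-assoc′ (tail f) g h n)) ⟩
    f 0 ⊗ g 0 ⊗ h (suc n) ⊕ (f 0 ⊗ (tail g * h) n ⊕ (tail f * (g * h)) n)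
      ≈⟨ solve 5 (λ a b d u v → a :* b :* d :+ (a :* u :+ v) := a :* (b :* d :+ u) :+ v) refl
           (f 0) (g 0) (h (suc n)) ((tail g * h) n) ((tail f * (g * h)) n) ⟩
    (f * (g * h)) (suc n) ∎

  -- The mirror image of the definitional unfolding, with the tail taken in the right factor;
  -- commutativity plays the two against each other.
  *-suc : ∀ f g n → (f * g) (suc n) ≈ (f * tail g) n ⊕ f (suc n) ⊗ g 0
  *-suc f g zero    = trans (+-congˡ (+-identityʳ _)) (+-congʳ (sym (+-identityʳ _)))
  *-suc f g (suc n) = trans (+-congˡ (*-suc (tail f) g n)) (sym (+-assoc _ _ _))

  *-comm′ : ∀ f g → f * g ≋ g * f
  *-comm′ f g zero    = +-congʳ (*-comm _ _)
  *-comm′ f g (suc n) = begin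
    f 0 ⊗ g (suc n) ⊕ (tail f * g) n ≈⟨ +-cong (*-comm _ _) (*-comm′ (tail f) g n) ⟩
    g (suc n) ⊗ f 0 ⊕ (g * tail f) n ≈⟨ +-comm _ _ ⟩
    (g * tail f) n ⊕ g (suc n) ⊗ f 0 ≈⟨ sym (*-suc g f n) ⟩
    (g * f) (suc n) ∎

  seriesRing : CommutativeRing c ℓ
  seriesRing = record
    { Carrier = Series ; _≈_ = _≋_ ; _+_ = _+_ ; _*_ = _*_ ; -_ = -_ ; 0# = 0# ; 1# = 1#
    ; isCommutativeRing = record
      { isRing = record
        { +-isAbelianGroup = record
          { isGroup = record
            { isMonoid = record
              { isSemigroup = record
                { isMagma = record
                  { isEquivalence = record
                    { refl = λ n → refl ; sym = λ p n → sym (p n) ; trans = λ p q n → trans (p n) (q n) }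
                  ; ∙-cong = λ p q n → +-cong (p n) (q n) }
                ; assoc = λ f g h n → +-assoc _ _ _ }
              ; identity = (λ f n → trans (+-congʳ (0#-coefficient n)) (+-identityˡ _))
                         , (λ f n → trans (+-congˡ (0#-coefficient n)) (+-identityʳ _)) }
            ; inverse = (λ f n → trans (-‿inverseˡ _) (sym (0#-coefficient n)))
                      , (λ f n → trans (-‿inverseʳ _) (sym (0#-coefficient n)))
            ; ⁻¹-cong = λ p n → -‿cong (p n) }
          ; comm = λ f g n → +-comm _ _ }
        ; *-cong = λ {f} {f′} {g} {g′} → *-cong {f} {f′} {g} {g′}
        ; *-assoc = *-assoc′
        ; *-identity = *-identityˡ′ , λ f n → trans (*-comm′ f 1# n) (*-identityˡ′ f n)
        ; distrib = (λ h f g n → trans (*-comm′ h (f + g) n)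
                      (trans (distribʳ h f g n) (+-cong (*-comm′ f h n) (*-comm′ g h n))))
                  , distribʳ }
      ; *-comm = *-comm′ } }

  const-cong : ∀ {a b} → a ≈ b → const a ≋ const b
  const-cong a≈b zero    = a≈b
  const-cong a≈b (suc n) = refl

  const-homo-* : ∀ a b → const (a ⊗ b) ≋ const a * const b
  const-homo-* a b n = trans (lemma n) (sym (const-* a (const b) n))
    where
    lemma : ∀ n → const (a ⊗ b) n ≈ a ⊗ const b n
    lemma zero    = refl
    lemma (suc n) = sym (R.zeroʳ a)

  open import Algebra.Properties.Semiring.Exp R.semiring using () renaming (_^_ to _^ᴿ_)

  const-homo-^ : ∀ a n → const (a ^ᴿ n) ≋ const a ^ n
  const-homo-^ a zero    k = refl
  const-homo-^ a (suc n) k = trans (const-homo-* a (a ^ᴿ n) k)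
    (*-cong {const a} {const a} {const (a ^ᴿ n)} {const a ^ n} (λ _ → refl) (const-homo-^ a n) k)

  constant-* : ∀ f g → f 0 ≈ R.1# → g 0 ≈ R.1# → (f * g) 0 ≈ R.1#
  constant-* f g f≈1 g≈1 = trans (+-identityʳ _) (trans (R.*-cong f≈1 g≈1) (R.*-identityˡ _))

  const-inverse : ∀ {a b} → a ⊗ b ≈ R.1# → const a * const b ≋ 1#
  const-inverse {a} {b} ab≈1 n = trans (sym (const-homo-* a b n)) (const-cong ab≈1 n)

-- Dyck paths and their water capacity

module DyckPaths where
  open import Data.List.Base using (reverse; upTo; applyUpTo)
  open import Data.List.Membership.Propositional using (_∈_; _∉_)
  open import Data.List.Properties
    using (reverse-++; unfold-reverse; reverse-involutive; map-upTo; map-++; ++-identityʳ)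
  open import Data.List.Relation.Unary.Any using (here; there)
  open import Data.List.Relation.Unary.Any.Properties using (reverse⁺; reverse⁻)
  open import Data.Nat.Base using (_+_; _⊔_; s≤s⁻¹)
  open import Data.Nat.ListAction using (sum)
  open import Data.Nat.ListAction.Properties using (sum-++)
  open import Data.Sum.Base using (_⊎_; inj₁; inj₂)
  open import Relation.Binary.PropositionalEquality

  total : ℕ → (ℕ → ℕ) → ℕ
  total n f = sum (applyUpTo f n)

  total-cong : ∀ n {f g : ℕ → ℕ} → (∀ i → i < n → f i ≡ g i) → total n f ≡ total n g
  total-cong zero    f≡g = refl
  total-cong (suc n) f≡g = cong₂ _+_ (f≡g 0 (s≤s z≤n)) (total-cong n λ i i<n → f≡g (suc i) (s≤s i<n))

  total-suc : ∀ n f → total (suc n) f ≡ total n f + f n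
  total-suc zero    f = ℕ.+-identityʳ _
  total-suc (suc n) f = trans (cong (f 0 +_) (total-suc n (f ∘ suc))) (sym (ℕ.+-assoc (f 0) _ _))

  module _ (s : LevelStep) where

    beforeFirst-here : ∀ ls → beforeFirst s (s ∷ ls) ≡ []
    beforeFirst-here ls with s ≟ˡ s
    ... | yes _  = refl
    ... | no s≢s = ⊥-elim (s≢s refl)

    beforeFirst-there : ∀ {t} ls → s ≢ t → beforeFirst s (t ∷ ls) ≡ t ∷ beforeFirst s ls
    beforeFirst-there {t} ls s≢t with s ≟ˡ t
    ... | yes s≡t = ⊥-elim (s≢t s≡t)
    ... | no _    = refl

    afterFirst-here : ∀ ls → afterFirst s (s ∷ ls) ≡ ls
    afterFirst-here ls with s ≟ˡ s
    ... | yes _  = refl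
    ... | no s≢s = ⊥-elim (s≢s refl)

    afterFirst-there : ∀ {t} ls → s ≢ t → afterFirst s (t ∷ ls) ≡ afterFirst s ls
    afterFirst-there {t} ls s≢t with s ≟ˡ t
    ... | yes s≡t = ⊥-elim (s≢t s≡t)
    ... | no _    = refl

    beforeFirst-++-∈ : ∀ xs ys → s ∈ xs → beforeFirst s (xs ++ ys) ≡ beforeFirst s xs
    beforeFirst-++-∈ (t ∷ xs) ys s∈ with s ≟ˡ t | s∈
    ... | yes _  | _         = refl
    ... | no s≢t | here s≡t  = ⊥-elim (s≢t s≡t)
    ... | no _   | there s∈′ = cong (t ∷_) (beforeFirst-++-∈ xs ys s∈′)

    beforeFirst-++-∉ : ∀ xs ys → s ∉ xs → beforeFirst s (xs ++ ys) ≡ xs ++ beforeFirst s ys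
    beforeFirst-++-∉ []       ys s∉ = refl
    beforeFirst-++-∉ (t ∷ xs) ys s∉ with s ≟ˡ t
    ... | yes s≡t = ⊥-elim (s∉ (here s≡t))
    ... | no _    = cong (t ∷_) (beforeFirst-++-∉ xs ys (s∉ ∘ there))

    afterFirst-++-∈ : ∀ xs ys → s ∈ xs → afterFirst s (xs ++ ys) ≡ afterFirst s xs ++ ys
    afterFirst-++-∈ (t ∷ xs) ys s∈ with s ≟ˡ t | s∈
    ... | yes _  | _         = refl
    ... | no s≢t | here s≡t  = ⊥-elim (s≢t s≡t)
    ... | no _   | there s∈′ = afterFirst-++-∈ xs ys s∈′

    afterFirst-++-∉ : ∀ xs ys → s ∉ xs → afterFirst s (xs ++ ys) ≡ afterFirst s ys
    afterFirst-++-∉ []       ys s∉ = refl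
    afterFirst-++-∉ (t ∷ xs) ys s∉ with s ≟ˡ t
    ... | yes s≡t = ⊥-elim (s∉ (here s≡t))
    ... | no _    = afterFirst-++-∉ xs ys (s∉ ∘ there)

    -- After reversal t stands at the far end, behind an occurrence of s, where the search for the
    -- first s does not reach it.
    beforeLast-∈ : ∀ t ls → s ∈ ls → beforeLast s (t ∷ ls) ≡ t ∷ beforeLast s ls
    beforeLast-∈ t ls s∈ = begin
      reverse (afterFirst s (reverse (t ∷ ls)))         ≡⟨ cong (reverse ∘ afterFirst s) (unfold-reverse t ls) ⟩
      reverse (afterFirst s (reverse ls ++ t ∷ []))     ≡⟨ cong reverse (afterFirst-++-∈ (reverse ls) _ (reverse⁺ s∈)) ⟩
      reverse (afterFirst s (reverse ls) ++ t ∷ [])     ≡⟨ reverse-++ (afterFirst s (reverse ls)) (t ∷ []) ⟩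
      t ∷ beforeLast s ls ∎
      where open ≡-Reasoning

    beforeLast-∉ : ∀ ls → s ∉ ls → beforeLast s (s ∷ ls) ≡ []
    beforeLast-∉ ls s∉ = begin
      reverse (afterFirst s (reverse (s ∷ ls)))         ≡⟨ cong (reverse ∘ afterFirst s) (unfold-reverse s ls) ⟩
      reverse (afterFirst s (reverse ls ++ s ∷ []))     ≡⟨ cong reverse (afterFirst-++-∉ (reverse ls) _ (s∉ ∘ reverse⁻)) ⟩
      reverse (afterFirst s (s ∷ []))                   ≡⟨ cong reverse (afterFirst-here []) ⟩
      [] ∎
      where open ≡-Reasoning

    afterLast-∈ : ∀ t ls → s ∈ ls → afterLast s (t ∷ ls) ≡ afterLast s ls
    afterLast-∈ t ls s∈ = cong reverse
      (trans (cong (beforeFirst s) (unfold-reverse t ls)) (beforeFirst-++-∈ (reverse ls) _ (reverse⁺ s∈)))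

    afterLast-∉ : ∀ ls → s ∉ ls → afterLast s (s ∷ ls) ≡ ls
    afterLast-∉ ls s∉ = begin
      reverse (beforeFirst s (reverse (s ∷ ls)))        ≡⟨ cong (reverse ∘ beforeFirst s) (unfold-reverse s ls) ⟩
      reverse (beforeFirst s (reverse ls ++ s ∷ []))    ≡⟨ cong reverse (beforeFirst-++-∉ (reverse ls) _ (s∉ ∘ reverse⁻)) ⟩
      reverse (reverse ls ++ beforeFirst s (s ∷ []))    ≡⟨ cong (λ l → reverse (reverse ls ++ l)) (beforeFirst-here []) ⟩
      reverse (reverse ls ++ [])                        ≡⟨ cong reverse (++-identityʳ (reverse ls)) ⟩
      reverse (reverse ls)                              ≡⟨ reverse-involutive ls ⟩
      ls ∎
      where open ≡-Reasoning

  top : ℕ → List Step → ℕ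
  top c w = foldr _⊔_ 0 (vertices c w)

  areaFrom : ℕ → List Step → ℕ
  areaFrom c w = sum (map proj₂ (levelSteps c w))

  start≤top : ∀ c w → c ≤ top c w
  start≤top c []      = ℕ.m≤m⊔n c 0
  start≤top c (s ∷ w) = ℕ.m≤m⊔n c _

  -- Falling c d w: the Dyck suffix w starts at height c and its maximum is c + d,
  -- where c + d is at most the maximum of the part before it.  The constructor
  -- last is the last down-step from the maximum of the suffix.
  data Falling : ℕ → ℕ → List Step → Set where
    []   : Falling 0 0 []
    rise : ∀ {c d w} → Falling (suc c) d w → Falling c (suc d) (U ∷ w)
    fall : ∀ {c d w} → Falling c (suc d) w → Falling (suc c) d (D ∷ w)
    last : ∀ {c w} → Falling c 0 w → Falling (suc c) 0 (D ∷ w)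

  -- Rising c d m w: the Dyck suffix w starts at height c, the maximum so far is
  -- c + d and the maximum of w is 1 + c + d + m.  The constructors first and
  -- final are the first up-steps to a new level, final being the one to the
  -- overall maximum.
  data Rising : ℕ → ℕ → ℕ → List Step → Set where
    rise  : ∀ {c d m w} → Rising (suc c) d m w → Rising c (suc d) m (U ∷ w)
    fall  : ∀ {c d m w} → Rising c (suc d) m w → Rising (suc c) d m (D ∷ w)
    first : ∀ {c m w} → Rising (suc c) 0 m w → Rising c 0 (suc m) (U ∷ w)
    final : ∀ {c w} → Falling (suc c) 0 w → Rising c 0 0 (U ∷ w)

  top-U : ∀ c w → top c (U ∷ w) ≡ top (suc c) w
  top-U c w = ℕ.m≤n⇒m⊔n≡n (ℕ.≤-trans (ℕ.n≤1+n c) (start≤top (suc c) w))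

  top-D-below : ∀ {c w k} → top c w ≡ suc c + k → top (suc c) (D ∷ w) ≡ suc c + k
  top-D-below {c} {w} {k} eq = trans (cong (suc c ⊔_) eq) (ℕ.m≤n⇒m⊔n≡n (ℕ.m≤m+n (suc c) k))

  falling⇒dyck : ∀ {c d w} → Falling c d w → DyckFrom c w
  falling⇒dyck []       = []
  falling⇒dyck (rise f)   = U∷ falling⇒dyck f
  falling⇒dyck (fall f) = D∷ falling⇒dyck f
  falling⇒dyck (last f) = D∷ falling⇒dyck f

  falling⇒top : ∀ {c d w} → Falling c d w → top c w ≡ c + d
  falling⇒top []                      = refl
  falling⇒top {c} {suc d} {U ∷ w} (rise f) = trans (top-U c w) (trans (falling⇒top f) (sym (ℕ.+-suc c d)))
  falling⇒top {suc c} {d} {D ∷ w} (fall f) = top-D-below {c} {w} (trans (falling⇒top f) (ℕ.+-suc c d))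
  falling⇒top {suc c} {0} {D ∷ w} (last f) =
    trans (ℕ.m≥n⇒m⊔n≡m (ℕ.≤-trans (ℕ.≤-reflexive (trans (falling⇒top f) (ℕ.+-identityʳ c))) (ℕ.n≤1+n c)))
      (sym (ℕ.+-identityʳ (suc c)))

  rising⇒dyck : ∀ {c d m w} → Rising c d m w → DyckFrom c w
  rising⇒dyck (rise r)    = U∷ rising⇒dyck r
  rising⇒dyck (fall r)  = D∷ rising⇒dyck r
  rising⇒dyck (first r) = U∷ rising⇒dyck r
  rising⇒dyck (final f) = U∷ falling⇒dyck f

  rising⇒top : ∀ {c d m w} → Rising c d m w → top c w ≡ suc (c + d + m)
  rising⇒top {c} {suc d} {m} {U ∷ w} (rise r) =
    trans (top-U c w) (trans (rising⇒top r) (cong (λ k → suc (k + m)) (sym (ℕ.+-suc c d))))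
  rising⇒top {suc c} {d} {m} {D ∷ w} (fall r) =
    trans (top-D-below {c} {w} {suc (d + m)} (trans (rising⇒top r)
       (cong suc (trans (cong (_+ m) (ℕ.+-suc c d)) (trans (cong suc (ℕ.+-assoc c d m)) (sym (ℕ.+-suc c (d + m))))))))
     (cong suc (trans (ℕ.+-suc c (d + m)) (cong suc (sym (ℕ.+-assoc c d m)))))
  rising⇒top {c} {0} {suc m} {U ∷ w} (first r) =
    trans (top-U c w) (trans (rising⇒top r) (cong suc (sym (ℕ.+-suc (c + 0) m))))
  rising⇒top {c} {0} {0} {U ∷ w} (final f) =
    trans (top-U c w) (trans (falling⇒top f) (cong suc (sym (ℕ.+-identityʳ (c + 0)))))

  -- The dichotomy behind `fall` and `last`: after a down-step from suc c the maximum is still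
  -- attained, or that step was the last one at the maximum and the rest stays at most at c.
  top-D : ∀ c d t → suc c ⊔ t ≡ suc c + d → t ≡ suc c + d ⊎ (d ≡ 0 × t ≤ c)
  top-D c d t eq with suc c ℕ.≤? t
  ... | yes c<t = inj₁ (trans (sym (ℕ.m≤n⇒m⊔n≡n c<t)) eq)
  ... | no  c≮t = inj₂
    ( ℕ.+-cancelˡ-≡ (suc c) d 0 (trans (sym eq) (trans (ℕ.m≥n⇒m⊔n≡m (ℕ.≤-trans t≤c (ℕ.n≤1+n c))) (sym (ℕ.+-identityʳ _))))
    , t≤c )
    where t≤c = s≤s⁻¹ (ℕ.≰⇒> c≮t)

  dyck⇒falling : ∀ {c d w} → DyckFrom c w → top c w ≡ c + d → Falling c d w
  dyck⇒falling {d = zero} [] eq = []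
  dyck⇒falling {c} {zero}  {U ∷ w} (U∷ δ) eq = ⊥-elim (ℕ.1+n≰n
    (ℕ.≤-trans (start≤top (suc c) w) (ℕ.≤-reflexive (trans (sym (top-U c w)) (trans eq (ℕ.+-identityʳ c))))))
  dyck⇒falling {c} {suc d} {U ∷ w} (U∷ δ) eq =
    rise (dyck⇒falling δ (trans (sym (top-U c w)) (trans eq (ℕ.+-suc c d))))
  dyck⇒falling {suc c} {d} {D ∷ w} (D∷ δ) eq with top-D c d (top c w) eq
  ... | inj₁ t≡           = fall (dyck⇒falling δ (trans t≡ (sym (ℕ.+-suc c d))))
  ... | inj₂ (refl , t≤c) =
    last (dyck⇒falling δ (trans (ℕ.≤-antisym t≤c (start≤top c w)) (sym (ℕ.+-identityʳ c))))

  dyck⇒rising : ∀ {c d m w} → DyckFrom c w → top c w ≡ suc (c + d + m) → Rising c d m w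
  dyck⇒rising {c} {suc d} {m} {U ∷ w} (U∷ δ) eq =
    rise (dyck⇒rising δ (trans (sym (top-U c w)) (trans eq (cong (λ k → suc (k + m)) (ℕ.+-suc c d)))))
  dyck⇒rising {c} {zero} {suc m} {U ∷ w} (U∷ δ) eq =
    first (dyck⇒rising δ (trans (sym (top-U c w)) (trans eq (cong suc (ℕ.+-suc (c + 0) m)))))
  dyck⇒rising {c} {zero} {zero} {U ∷ w} (U∷ δ) eq =
    final (dyck⇒falling δ (trans (sym (top-U c w)) (trans eq (cong suc (ℕ.+-identityʳ (c + 0))))))
  dyck⇒rising {suc c} {d} {m} {D ∷ w} (D∷ δ) eq
    with top-D c (suc (d + m)) (top c w) (trans eq (cong suc (trans (cong suc (ℕ.+-assoc c d m)) (sym (ℕ.+-suc c (d + m))))))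
  -- The other alternative is absurd: the maximum lies suc (d + m) > 0 above the start of the step.
  ... | inj₁ t≡ = fall (dyck⇒rising δ (trans t≡ (cong suc
    (trans (ℕ.+-suc c (d + m)) (trans (cong suc (sym (ℕ.+-assoc c d m))) (cong (_+ m) (sym (ℕ.+-suc c d))))))))

  -- The water capacity read step by step along a suffix.

  gapArea : List LevelStep → ℕ
  gapArea = area ∘ reflect

  -- The water held by the gaps that meet a Falling suffix with steps ls and
  -- maximum M, the part of its first gap within ls being seen from depth d.
  fallingWater : ℕ → ℕ → List LevelStep → ℕ
  fallingWater d M ls =
    areaFrom d (reflect (beforeLast (down M) ls)) + total (pred M) (λ i → gapArea (rightGap (suc i) ls))

  -- A suffix reaching its maximum and ending at 0 must still descend through every level, so the
  -- marks D of all these levels lie ahead.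
  ∈-falling : ∀ {c d w} → Falling c d w → ∀ k → k < c + d → down (suc k) ∈ levelSteps c w
  ∈-falling {c} {suc d} (rise f) k k< = there (∈-falling f k (subst (k <_) (ℕ.+-suc c d) k<))
  ∈-falling {suc c} {d} (fall f) k k< = there (∈-falling f k (subst (k <_) (sym (ℕ.+-suc c d)) k<))
  ∈-falling {suc c}     (last f) k k< with ℕ.m≤n⇒m<n∨m≡n k<
  ... | inj₁ k<′  = there (∈-falling f k (s≤s⁻¹ k<′))
  ... | inj₂ refl = here (cong (λ k → D , suc k) (ℕ.+-identityʳ c))

  ∈-falling-≤ : ∀ {c d w s k} → Falling c d w → (s , k) ∈ levelSteps c w → k ≤ c + d
  ∈-falling-≤ {c} {suc d} (rise f) (here refl) = ℕ.m≤m+n c (suc d)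
  ∈-falling-≤ {c} {suc d} (rise f) (there k∈)   = ℕ.≤-trans (∈-falling-≤ f k∈) (ℕ.≤-reflexive (sym (ℕ.+-suc c d)))
  ∈-falling-≤ {suc c} {d} (fall f) (here refl) = ℕ.m≤m+n (suc c) d
  ∈-falling-≤ {suc c} {d} (fall f) (there k∈)   = ℕ.≤-trans (∈-falling-≤ f k∈) (ℕ.≤-reflexive (ℕ.+-suc c d))
  ∈-falling-≤ {suc c}     (last f) (here refl) = ℕ.m≤m+n (suc c) 0
  ∈-falling-≤ {suc c}     (last f) (there k∈)   = ℕ.m≤n⇒m≤1+n (∈-falling-≤ f k∈)

  ∈-rising : ∀ {c d m w} → Rising c d m w → ∀ k → k ≤ c + d + m → down (suc k) ∈ levelSteps c w
  ∈-rising {c} {suc d} {m} (rise r)  k k≤ = there (∈-rising r k (subst (λ l → k ≤ l + m) (ℕ.+-suc c d) k≤))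
  ∈-rising {suc c} {d} {m} (fall r)  k k≤ = there (∈-rising r k (subst (λ l → k ≤ l + m) (sym (ℕ.+-suc c d)) k≤))
  ∈-rising {c} {0} {suc m} (first r) k k≤ = there (∈-rising r k (subst (k ≤_) (ℕ.+-suc (c + 0) m) k≤))
  ∈-rising {c} {0} {0}     (final f) k k≤ = there (∈-falling f k (s≤s (subst (k ≤_) (ℕ.+-identityʳ (c + 0)) k≤)))

  rightGap-∷ : ∀ k t ls → down (suc k) ∈ ls → rightGap k (t ∷ ls) ≡ rightGap k ls
  rightGap-∷ k t ls downs = cong (beforeLast (down k)) (afterLast-∈ (down (suc k)) t ls downs)

  rightGaps-∷ : ∀ M t ls → (∀ k → k < M → down (suc k) ∈ ls) →
    total (pred M) (λ i → gapArea (rightGap (suc i) (t ∷ ls))) ≡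
    total (pred M) (λ i → gapArea (rightGap (suc i) ls))
  rightGaps-∷ zero    t ls downs = refl
  rightGaps-∷ (suc M) t ls downs =
    total-cong M λ i i<M → cong gapArea (rightGap-∷ (suc i) t ls (downs (suc i) (s≤s i<M)))

  down-∈ : ∀ {ls} M → 0 < M → (∀ k → k < M → down (suc k) ∈ ls) → down M ∈ ls
  down-∈ (suc M) _ downs = downs M ℕ.≤-refl

  -- All marks lie in ls, so the step belongs to the gap being read. In the reflected gap it starts
  -- at height d, which is its share of the area, and moves in the opposite direction.
  fallingWater-skip : ∀ {d M} s c ls → 0 < M → (∀ k → k < M → down (suc k) ∈ ls) →
    fallingWater d M ((s , c) ∷ ls) ≡ d + fallingWater (move (flip s) d) M ls
  fallingWater-skip {d} {M} s c ls 0<M downs = trans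
    (cong₂ _+_ (cong (areaFrom d ∘ reflect) (beforeLast-∈ (down M) (s , c) ls (down-∈ M 0<M downs)))
       (rightGaps-∷ M (s , c) ls downs))
    (ℕ.+-assoc d _ _)

  -- The step is itself the mark D at level suc c, so the gap being read ends before it and holds
  -- nothing more. The right gap at level c, the last term of the sum, becomes the one being read.
  fallingWater-last : ∀ {c w} → Falling c 0 w →
    fallingWater 0 (suc c) (levelSteps (suc c) (D ∷ w)) ≡ fallingWater 0 c (levelSteps c w)
  fallingWater-last {c} {w} f = trans
    (cong₂ _+_ (cong (areaFrom 0 ∘ reflect) (beforeLast-∉ (down (suc c)) ls absent)) refl)
    (rest c (λ k k<c → ∈-falling f k (ℕ.≤-trans k<c (ℕ.≤-reflexive (sym (ℕ.+-identityʳ c))))) absent (base f))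
    where
    ls = levelSteps c w
    absent : down (suc c) ∉ ls
    absent k∈ = ℕ.1+n≰n (ℕ.≤-trans (∈-falling-≤ f k∈) (ℕ.≤-reflexive (ℕ.+-identityʳ c)))
    base : ∀ {c w} → Falling c 0 w → c ≡ 0 → levelSteps c w ≡ []
    base [] _ = refl
    rest : ∀ c {ls} → (∀ k → k < c → down (suc k) ∈ ls) → down (suc c) ∉ ls → (c ≡ 0 → ls ≡ []) →
      total c (λ i → gapArea (rightGap (suc i) (down (suc c) ∷ ls))) ≡ fallingWater 0 c ls
    -- At level 0 no gap is left. The first term of `fallingWater` then refers to `down 0`, which
    -- marks no step, and is 0 because the suffix is empty.
    rest zero         downs absent base rewrite base refl = refl
    rest (suc c) {ls} downs absent base = begin
      total (suc c) F                         ≡⟨ total-suc c F ⟩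
      total c F + F c                         ≡⟨ ℕ.+-comm (total c F) (F c) ⟩
      F c + total c F                         ≡⟨ cong₂ _+_ (cong (gapArea ∘ beforeLast (down (suc c))) (afterLast-∉ (down (suc (suc c))) ls absent))
                                                   (rightGaps-∷ (suc c) (down (suc (suc c))) ls downs) ⟩
      fallingWater 0 (suc c) ls ∎
      where
      open ≡-Reasoning
      F = λ i → gapArea (rightGap (suc i) (down (suc (suc c)) ∷ ls))

  -- As fallingWater, for a Rising suffix whose maximum so far is a and whose
  -- overall maximum is 1 + a + m.
  risingWater : ℕ → ℕ → ℕ → List LevelStep → ℕ
  risingWater d a m ls =
    areaFrom d (reflect (beforeFirst (up (suc a)) ls))
    + (total m (λ i → gapArea (leftGap (suc (a + i)) ls))
    + (gapArea (topGap (suc (a + m)) ls)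
    + total (a + m) (λ i → gapArea (rightGap (suc i) ls))))

  -- By `distinct` the step is none of the up-marks still to come, and by `downs` the down-marks lie
  -- behind it; so it only adds its depth d to the gap being read.
  risingWater-skip : ∀ d a m s c ls → (∀ k → (U , a + k) ≢ (s , c)) →
    (∀ k → k ≤ a + m → down (suc k) ∈ ls) →
    risingWater d a m ((s , c) ∷ ls) ≡ d + risingWater (move (flip s) d) a m ls
  risingWater-skip d a m s c ls distinct downs = trans
    (cong₂ _+_ (cong (areaFrom d ∘ reflect) (beforeFirst-there (U , a) ls (subst (λ k → (U , k) ≢ (s , c)) (ℕ.+-identityʳ a) (distinct 0))))
    (cong₂ _+_ (total-cong m λ i _ → cong (gapArea ∘ beforeFirst (up (suc (suc (a + i))))) (afterFirst-there (U , a + i) ls (distinct i)))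
    (cong₂ _+_ (cong (gapArea ∘ beforeLast (down (suc (a + m)))) (afterFirst-there (U , a + m) ls (distinct m)))
      (rightGaps-∷ (suc (a + m)) (s , c) ls (λ k k< → downs k (s≤s⁻¹ k<))))))
    (ℕ.+-assoc d _ _)

  -- The step is the mark U at level suc a: it closes the gap being read, and the left gap at level
  -- suc a, the term i = 0 of the sum, takes its place.
  risingWater-first : ∀ a m ls → (∀ k → k ≤ a + suc m → down (suc k) ∈ ls) →
    risingWater 0 a (suc m) ((U , a) ∷ ls) ≡ risingWater 0 (suc a) m ls
  risingWater-first a m ls downs = trans
    (cong₂ _+_ (cong (areaFrom 0 ∘ reflect) (beforeFirst-here (U , a) ls))
    (cong₂ _+_ (cong₂ _+_
        (trans (cong (λ k → gapArea (leftGap (suc k) ((U , a) ∷ ls))) (ℕ.+-identityʳ a))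
          (cong (gapArea ∘ beforeFirst (up (suc (suc a)))) (afterFirst-here (U , a) ls)))
        (total-cong m λ i _ → trans (cong (λ k → gapArea (leftGap (suc k) ((U , a) ∷ ls))) (ℕ.+-suc a i))
          (cong (gapArea ∘ beforeFirst (up (suc (suc (suc (a + i)))))) (afterFirst-there (U , suc (a + i)) ls (λ e → 1+≢ a i e)))))
    (cong₂ _+_ (trans (cong (λ k → gapArea (topGap (suc k) ((U , a) ∷ ls))) (ℕ.+-suc a m))
          (cong (gapArea ∘ beforeLast (down (suc (suc (a + m))))) (afterFirst-there (U , suc (a + m)) ls (1+≢ a m))))
      (trans (rightGaps-∷ (suc (a + suc m)) (U , a) ls (λ k k< → downs k (s≤s⁻¹ k<)))
        (cong (λ k → total k (λ i → gapArea (rightGap (suc i) ls))) (ℕ.+-suc a m))))))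
    (ℕ.+-assoc (gapArea (beforeFirst (up (suc (suc a))) ls)) _ _)
    where
    1+≢ : ∀ a i → (U , suc (a + i)) ≢ (U , a)
    1+≢ a i e = ℕ.m≢1+m+n a (sym (cong proj₂ e))

  -- The step is the up-mark of the overall maximum. The top gap opens after it and ends at a
  -- down-mark, so from here on it is read like a right gap.
  risingWater-final : ∀ a ls → (∀ k → k < suc a → down (suc k) ∈ ls) →
    risingWater 0 a 0 ((U , a) ∷ ls) ≡ fallingWater 0 (suc a) ls
  risingWater-final a ls downs =
    cong₂ _+_ (cong (areaFrom 0 ∘ reflect) (beforeFirst-here (U , a) ls))
    (cong₂ _+_ (trans (cong (λ k → gapArea (topGap (suc k) ((U , a) ∷ ls))) (ℕ.+-identityʳ a))
        (cong (gapArea ∘ beforeLast (down (suc a))) (afterFirst-here (U , a) ls)))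
      (trans (cong (λ k → total k (λ i → gapArea (rightGap (suc i) ((U , a) ∷ ls)))) (ℕ.+-identityʳ a))
        (rightGaps-∷ (suc a) (U , a) ls downs)))

  water-falling : ∀ {w} → Falling 0 0 w → water w ≡ fallingWater 0 0 (levelSteps 0 w)
  water-falling [] = refl

  water-rising : ∀ {m w} → Rising 0 0 m w → water w ≡ risingWater 0 0 m (levelSteps 0 w)
  water-rising {m} {w} r = begin
    sum (map gapArea (gapsUpTo (height w) ls))
      ≡⟨ cong (λ h → sum (map gapArea (gapsUpTo h ls))) (rising⇒top r) ⟩
    gapArea (topGap (suc m) ls) + sum (map gapArea (map L (upTo m) ++ map R (upTo m)))
      ≡⟨ cong (λ l → t + sum l) (map-++ gapArea (map L (upTo m)) _) ⟩
    t + sum (map gapArea (map L (upTo m)) ++ map gapArea (map R (upTo m)))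
      ≡⟨ cong (t +_) (sum-++ (map gapArea (map L (upTo m))) _) ⟩
    t + (sum (map gapArea (map L (upTo m))) + sum (map gapArea (map R (upTo m))))
      ≡⟨ cong (t +_) (cong₂ _+_ (total-upTo L) (total-upTo R)) ⟩
    t + (total m (gapArea ∘ L) + total m (gapArea ∘ R))
      ≡⟨ swap t (total m (gapArea ∘ L)) _ ⟩
    total m (gapArea ∘ L) + (t + total m (gapArea ∘ R))
      ≡⟨ sym (no-gap r) ⟩
    risingWater 0 0 m ls ∎
    where
    open ≡-Reasoning
    ls = levelSteps 0 w
    L = λ i → leftGap (suc i) ls
    R = λ i → rightGap (suc i) ls
    t = gapArea (topGap (suc m) ls)
    swap : ∀ a b c → a + (b + c) ≡ b + (a + c)
    swap a b c = trans (sym (ℕ.+-assoc a b c)) (trans (cong (_+ c) (ℕ.+-comm a b)) (ℕ.+-assoc b a c))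
    total-upTo : ∀ f → sum (map gapArea (map f (upTo m))) ≡ total m (gapArea ∘ f)
    total-upTo f = cong sum (trans (sym (map-∘ (upTo m))) (map-upTo (gapArea ∘ f) m))
    -- `risingWater` also counts the steps before U_1, which form no gap; there are none, since a
    -- nonempty path begins with U_1.
    no-gap : ∀ {m w} → Rising 0 0 m w →
      ∀ {n} → areaFrom 0 (reflect (beforeFirst (up 1) (levelSteps 0 w))) + n ≡ n
    no-gap (first r) = refl
    no-gap (final f) = refl

  dyckFrom⇒≤length : ∀ {c w} → DyckFrom c w → c ≤ length w
  dyckFrom⇒≤length []     = z≤n
  dyckFrom⇒≤length (U∷ δ) = ℕ.≤-trans (ℕ.n≤1+n _) (ℕ.m≤n⇒m≤1+n (dyckFrom⇒≤length δ))
  dyckFrom⇒≤length (D∷ δ) = s≤s (dyckFrom⇒≤length δ)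

  words-length : ∀ k → All (λ w → length w ≡ k) (words k)
  words-length zero    = refl ∷ []
  words-length (suc k) = All.++⁺ (All.map⁺ (All.map (cong suc) (words-length k)))
                                 (All.map⁺ (All.map (cong suc) (words-length k)))

  top≤start+length : ∀ c w → top c w ≤ c + length w
  top≤start+length c []      = ℕ.≤-reflexive (trans (ℕ.⊔-identityʳ c) (sym (ℕ.+-identityʳ c)))
  top≤start+length c (s ∷ w) = ℕ.⊔-lub (ℕ.m≤m+n c _) (ℕ.≤-trans (top≤start+length (move s c) w)
    (ℕ.≤-trans (ℕ.+-monoˡ-≤ (length w) (move≤suc s c)) (ℕ.≤-reflexive (sym (ℕ.+-suc c (length w))))))
    where
    move≤suc : ∀ s c → move s c ≤ suc c
    move≤suc U c = ℕ.≤-refl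
    move≤suc D c = ℕ.≤-trans ℕ.pred[n]≤n (ℕ.n≤1+n c)

open DyckPaths

-- Weights of words by area and water.

module Weights {c ℓ} (R : CommutativeRing c ℓ) (p q : CommutativeRing.Carrier R) where
  open CommutativeRing R hiding (zero)
  open import Algebra.Properties.Semiring.Exp semiring using (_^_; ^-homo-*; ^-congʳ)
  open import Algebra.Solver.Ring.NaturalCoefficients.Default commutativeSemiring
    using (solve; _:=_; _:*_)
  open SetoidReasoning setoid

  κ : ℕ → ℕ → Carrier
  κ c d = q ^ c * p ^ d

  -- ρ w c d (resp. σ w c d m) is q ^ area * p ^ water if Falling c d w
  -- (resp. Rising c d m w), and 0 otherwise.
  ρ : List Step → ℕ → ℕ → Carrier
  ρ []      c       (suc d) = 0#
  ρ []      zero    zero    = 1#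
  ρ []      (suc c) zero    = 0#
  ρ (U ∷ w) c       zero    = 0#
  ρ (U ∷ w) c       (suc d) = κ c (suc d) * ρ w (suc c) d
  ρ (D ∷ w) zero    d       = 0#
  ρ (D ∷ w) (suc c) zero    = κ (suc c) 0 * (ρ w c 0 + ρ w c 1)
  ρ (D ∷ w) (suc c) (suc d) = κ (suc c) (suc d) * ρ w c (suc (suc d))

  σ : List Step → ℕ → ℕ → ℕ → Carrier
  σ []      c       d       m       = 0#
  σ (U ∷ w) c       zero    zero    = κ c 0 * ρ w (suc c) 0
  σ (U ∷ w) c       zero    (suc m) = κ c 0 * σ w (suc c) 0 m
  σ (U ∷ w) c       (suc d) m       = κ c (suc d) * σ w (suc c) d m
  σ (D ∷ w) zero    d       m       = 0#
  σ (D ∷ w) (suc c) d       m       = κ (suc c) d * σ w c (suc d) m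

  κ-shift : ∀ c d {a w u} → u ≈ q ^ a * p ^ w → κ c d * u ≈ q ^ (c +ℕ a) * p ^ (d +ℕ w)
  κ-shift c d {a} {w} {u} u≈ = begin
    κ c d * u                       ≈⟨ *-congˡ u≈ ⟩
    q ^ c * p ^ d * (q ^ a * p ^ w) ≈⟨ solve 4 (λ a b c d → a :* b :* (c :* d) := (a :* c) :* (b :* d)) refl _ _ _ _ ⟩
    q ^ c * q ^ a * (p ^ d * p ^ w) ≈⟨ *-cong (sym (^-homo-* q c a)) (sym (^-homo-* p d w)) ⟩
    q ^ (c +ℕ a) * p ^ (d +ℕ w) ∎

  p^-≡ : ∀ a {m n} → m ≡ n → q ^ a * p ^ n ≈ q ^ a * p ^ m
  p^-≡ a eq = *-congˡ (^-congʳ p (≡.sym eq))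

  annihilate : ∀ a {u} → u ≈ 0# → a * u ≈ 0#
  annihilate a u≈0 = trans (*-congˡ u≈0) (zeroʳ a)

  ρ-zero : ∀ c d w → ¬ Falling c d w → ρ w c d ≈ 0#
  ρ-zero c       (suc d) []      ¬f = refl
  ρ-zero zero    zero    []      ¬f = ⊥-elim (¬f [])
  ρ-zero (suc c) zero    []      ¬f = refl
  ρ-zero c       zero    (U ∷ w) ¬f = refl
  ρ-zero c       (suc d) (U ∷ w) ¬f = annihilate _ (ρ-zero (suc c) d w (¬f ∘ rise))
  ρ-zero zero    d       (D ∷ w) ¬f = refl
  ρ-zero (suc c) zero    (D ∷ w) ¬f = annihilate _
    (trans (+-cong (ρ-zero c 0 w (¬f ∘ last)) (ρ-zero c 1 w (¬f ∘ fall))) (+-identityʳ _))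
  ρ-zero (suc c) (suc d) (D ∷ w) ¬f = annihilate _ (ρ-zero c (suc (suc d)) w (¬f ∘ fall))

  -- The depth is the maximum minus c. Hence of the two summands that `ρ` has for a down-step at
  -- depth 0, one for `last` and one for `fall`, at most one comes from an actual suffix, and
  -- `ρ-zero` removes the other.
  falling-unique : ∀ {c d d′ w} → Falling c d w → Falling c d′ w → d ≡ d′
  falling-unique {c} f f′ = ℕ.+-cancelˡ-≡ c _ _ (≡.trans (≡.sym (falling⇒top f)) (falling⇒top f′))

  ρ-falling : ∀ {c d w} → Falling c d w → ∀ {M} → c +ℕ d ≡ M →
    ρ w c d ≈ q ^ areaFrom c w * p ^ fallingWater d M (levelSteps c w)
  ρ-falling [] ≡.refl = sym (*-identityˡ _)
  ρ-falling {c} {suc d} {U ∷ w} (rise f) {M} eq =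
    trans (κ-shift c (suc d) (ρ-falling f (≡.trans (≡.sym (ℕ.+-suc c d)) eq)))
      (p^-≡ (areaFrom c (U ∷ w)) (fallingWater-skip U c _
        (ℕ.≤-trans (s≤s z≤n) (ℕ.≤-trans (ℕ.m≤n+m (suc d) c) (ℕ.≤-reflexive eq)))
        λ k k<M → ∈-falling f k (ℕ.≤-trans k<M (ℕ.≤-reflexive (≡.trans (≡.sym eq) (ℕ.+-suc c d))))))
  ρ-falling {suc c} {d} {D ∷ w} (fall f) {M} eq =
    trans (step d f IH) (p^-≡ (areaFrom (suc c) (D ∷ w)) (fallingWater-skip D (suc c) _
        (ℕ.≤-trans (s≤s z≤n) (ℕ.≤-reflexive eq))
        λ k k<M → ∈-falling f k (ℕ.≤-trans k<M (ℕ.≤-reflexive (≡.sym eq′)))))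
    where
    eq′ : c +ℕ suc d ≡ M
    eq′ = ≡.trans (ℕ.+-suc c d) eq
    IH : ρ w c (suc d) ≈ q ^ areaFrom c w * p ^ fallingWater (suc d) M (levelSteps c w)
    IH = ρ-falling f eq′
    -- The split on d is forced by `ρ`, whose clause at depth 0 is a sum; there the summand for
    -- `last` vanishes.
    step : ∀ d → Falling c (suc d) w →
      ρ w c (suc d) ≈ q ^ areaFrom c w * p ^ fallingWater (suc d) M (levelSteps c w) →
      ρ (D ∷ w) (suc c) d ≈ q ^ (suc c +ℕ areaFrom c w) * p ^ (d +ℕ fallingWater (suc d) M (levelSteps c w))
    step zero    f IH = κ-shift (suc c) 0 {w = fallingWater 1 M (levelSteps c w)} (trans (+-congʳ (ρ-zero c 0 w λ f′ → ℕ.0≢1+n (falling-unique f′ f)))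
      (trans (+-identityˡ _) IH))
    step (suc d) f IH = κ-shift (suc c) (suc d) IH
  ρ-falling {suc c} {0} {D ∷ w} (last f) {M} eq =
    trans (κ-shift (suc c) 0 {w = fallingWater 0 c (levelSteps c w)} (trans (+-congˡ (ρ-zero c 1 w λ f′ → ℕ.0≢1+n (falling-unique f f′)))
      (trans (+-identityʳ _) (ρ-falling f (ℕ.+-identityʳ c)))))
      (p^-≡ (areaFrom (suc c) (D ∷ w)) (≡.trans (≡.cong (λ M → fallingWater 0 M (levelSteps (suc c) (D ∷ w)))
        (≡.trans (≡.sym eq) (ℕ.+-identityʳ (suc c)))) (fallingWater-last f)))

  σ-zero : ∀ c d m w → ¬ Rising c d m w → σ w c d m ≈ 0#
  σ-zero c       d       m       []      ¬r = refl
  σ-zero c       zero    zero    (U ∷ w) ¬r = annihilate _ (ρ-zero (suc c) 0 w (¬r ∘ final))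
  σ-zero c       zero    (suc m) (U ∷ w) ¬r = annihilate _ (σ-zero (suc c) 0 m w (¬r ∘ first))
  σ-zero c       (suc d) m       (U ∷ w) ¬r = annihilate _ (σ-zero (suc c) d m w (¬r ∘ rise))
  σ-zero zero    d       m       (D ∷ w) ¬r = refl
  σ-zero (suc c) d       m       (D ∷ w) ¬r = annihilate _ (σ-zero c (suc d) m w (¬r ∘ fall))

  σ-rising : ∀ {c d m w} → Rising c d m w → ∀ {a} → c +ℕ d ≡ a →
    σ w c d m ≈ q ^ areaFrom c w * p ^ risingWater d a m (levelSteps c w)
  σ-rising {c} {suc d} {m} {U ∷ w} (rise r) {a} eq =
    trans (κ-shift c (suc d) (σ-rising r (≡.trans (≡.sym (ℕ.+-suc c d)) eq)))
      (p^-≡ (areaFrom c (U ∷ w)) (risingWater-skip (suc d) a m U c _ distinct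
        λ k k≤ → ∈-rising r k (ℕ.≤-trans k≤ (ℕ.≤-reflexive (≡.cong (_+ℕ m) (≡.trans (≡.sym eq) (ℕ.+-suc c d)))))))
    where
    distinct : ∀ k → (U , a +ℕ k) ≢ (U , c)
    distinct k e = ℕ.m≢1+m+n c (≡.trans (≡.sym (≡.cong proj₂ e))
      (≡.trans (≡.cong (_+ℕ k) (≡.trans (≡.sym eq) (ℕ.+-suc c d))) (≡.cong suc (ℕ.+-assoc c d k))))
  σ-rising {suc c} {d} {m} {D ∷ w} (fall r) {a} eq =
    trans (κ-shift (suc c) d (σ-rising r eq′))
      (p^-≡ (areaFrom (suc c) (D ∷ w)) (risingWater-skip d a m D (suc c) _ (λ k ())
        λ k k≤ → ∈-rising r k (ℕ.≤-trans k≤ (ℕ.≤-reflexive (≡.cong (_+ℕ m) (≡.sym eq′))))))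
    where
    eq′ : c +ℕ suc d ≡ a
    eq′ = ≡.trans (ℕ.+-suc c d) eq
  σ-rising {c} {0} {suc m} {U ∷ w} (first r) eq with ≡.trans (≡.sym (ℕ.+-identityʳ c)) eq
  ... | ≡.refl = trans (κ-shift c 0 {w = risingWater 0 (suc c) m (levelSteps (suc c) w)} (σ-rising r (ℕ.+-identityʳ (suc c))))
    (p^-≡ (areaFrom c (U ∷ w)) (risingWater-first c m _
      λ k k≤ → ∈-rising r k (ℕ.≤-trans k≤ (ℕ.≤-reflexive
        (≡.trans (ℕ.+-suc c m) (≡.cong (λ l → suc l +ℕ m) (≡.sym (ℕ.+-identityʳ c))))))))
  σ-rising {c} {0} {0} {U ∷ w} (final f) eq with ≡.trans (≡.sym (ℕ.+-identityʳ c)) eq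
  ... | ≡.refl = trans (κ-shift c 0 {w = fallingWater 0 (suc c) (levelSteps (suc c) w)} (ρ-falling f (ℕ.+-identityʳ (suc c))))
    (p^-≡ (areaFrom c (U ∷ w)) (risingWater-final c _
      λ k k< → ∈-falling f k (ℕ.≤-trans k< (ℕ.≤-reflexive (≡.sym (ℕ.+-identityʳ (suc c)))))))

  τ : ℕ → List Step → Carrier
  τ zero    w = ρ w 0 0
  τ (suc h) w = σ w 0 0 h

  τ-dyck : ∀ {w} → Dyck w → ∀ {h} → height w ≡ h → τ h w ≈ p ^ water w * q ^ area w
  τ-dyck {w} δ {zero}  eq = trans (ρ-falling f ≡.refl) (trans (*-comm _ _)
    (*-congʳ (^-congʳ p (≡.sym (water-falling f)))))
    where f = dyck⇒falling {0} {0} δ eq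
  τ-dyck {w} δ {suc h} eq = trans (σ-rising r ≡.refl) (trans (*-comm _ _)
    (*-congʳ (^-congʳ p (≡.sym (water-rising r)))))
    where r = dyck⇒rising {0} {0} {h} δ eq

  τ-zero : ∀ h w → ¬ (Dyck w × height w ≡ h) → τ h w ≈ 0#
  τ-zero zero    w ¬δ = ρ-zero 0 0 w λ f → ¬δ (falling⇒dyck f , falling⇒top f)
  τ-zero (suc h) w ¬δ = σ-zero 0 0 h w λ r → ¬δ (rising⇒dyck r , rising⇒top r)

-- Enumeration

module WordSums {c ℓ} (R : CommutativeRing c ℓ) where
  open CommutativeRing R hiding (zero)
  open RingNotation rawRing using (sumTo)
  open RingNotationProperties R
  open import Algebra.Solver.Ring.NaturalCoefficients.Default commutativeSemiring
    using (solve; _:=_; _:+_)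
  open SetoidReasoning setoid

  listSum : (List Step → Carrier) → List (List Step) → Carrier
  listSum φ ws = foldr _+_ 0# (map φ ws)

  listSum-++ : ∀ φ vs ws → listSum φ (vs ++ ws) ≈ listSum φ vs + listSum φ ws
  listSum-++ φ []       ws = sym (+-identityˡ _)
  listSum-++ φ (v ∷ vs) ws = trans (+-congˡ (listSum-++ φ vs ws)) (sym (+-assoc _ _ _))

  listSum-cong : ∀ {φ ψ} → (∀ w → φ w ≈ ψ w) → ∀ ws → listSum φ ws ≈ listSum ψ ws
  listSum-cong φ≈ψ []       = refl
  listSum-cong φ≈ψ (w ∷ ws) = +-cong (φ≈ψ w) (listSum-cong φ≈ψ ws)

  listSum-+ : ∀ φ ψ ws → listSum (λ w → φ w + ψ w) ws ≈ listSum φ ws + listSum ψ ws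
  listSum-+ φ ψ []       = sym (+-identityˡ _)
  listSum-+ φ ψ (w ∷ ws) = trans (+-congˡ (listSum-+ φ ψ ws))
    (solve 4 (λ a b u v → (a :+ b) :+ (u :+ v) := (a :+ u) :+ (b :+ v)) refl _ _ _ _)

  listSum-* : ∀ a φ ws → listSum (λ w → a * φ w) ws ≈ a * listSum φ ws
  listSum-* a φ []       = sym (zeroʳ a)
  listSum-* a φ (w ∷ ws) = trans (+-congˡ (listSum-* a φ ws)) (sym (distribˡ a _ _))

  listSum-sumTo : ∀ n (φ : ℕ → List Step → Carrier) ws →
    listSum (λ w → sumTo n (λ h → φ h w)) ws ≈ sumTo n (λ h → listSum (φ h) ws)
  listSum-sumTo zero    φ ws = trans (listSum-cong (λ w → +-identityʳ _) ws) (sym (+-identityʳ _))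
  listSum-sumTo (suc n) φ ws =
    trans (listSum-+ (φ 0) (λ w → sumTo n (λ h → φ (suc h) w)) ws) (+-congˡ (listSum-sumTo n (φ ∘ suc) ws))

  -- Filtering is traded for a weight that is 0 on rejected words; the resulting sum over all words
  -- can be split by the first letter.
  listSum-filter : ∀ {P Q : List Step → Set} (P? : ∀ w → Dec (P w)) (Q? : ∀ w → Dec (Q w)) {φ ψ} →
    (∀ {w} → Q w → P w → φ w ≈ ψ w) → (∀ {w} → ¬ (Q w × P w) → φ w ≈ 0#) →
    ∀ ws → listSum ψ (filter P? (filter Q? ws)) ≈ listSum φ ws
  listSum-filter P? Q? inside outside []       = refl
  listSum-filter P? Q? inside outside (w ∷ ws) with Q? w
  ... | no ¬q = trans (listSum-filter P? Q? inside outside ws)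
    (sym (trans (+-congʳ (outside (¬q ∘ proj₁))) (+-identityˡ _)))
  ... | yes q with P? w
  ...   | no ¬p = trans (listSum-filter P? Q? inside outside ws)
    (sym (trans (+-congʳ (outside (¬p ∘ proj₂))) (+-identityˡ _)))
  ...   | yes p = +-cong (sym (inside q p)) (listSum-filter P? Q? inside outside ws)

  wordSum : ℕ → (List Step → Carrier) → Carrier
  wordSum k φ = listSum φ (words k)

  wordSum-suc : ∀ k φ → wordSum (suc k) φ ≈ wordSum k (φ ∘ (U ∷_)) + wordSum k (φ ∘ (D ∷_))
  wordSum-suc k φ = trans (listSum-++ φ (map (U ∷_) (words k)) (map (D ∷_) (words k)))
    (reflexive (≡.cong₂ (λ l r → foldr _+_ 0# l + foldr _+_ 0# r) (≡.sym (map-∘ (words k))) (≡.sym (map-∘ (words k)))))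

  wordSum-zero : ∀ k φ → (∀ w → length w ≡ k → φ w ≈ 0#) → wordSum k φ ≈ 0#
  wordSum-zero zero    φ φ≈0 = trans (+-identityʳ _) (φ≈0 [] ≡.refl)
  wordSum-zero (suc k) φ φ≈0 = begin
    wordSum (suc k) φ                                     ≈⟨ wordSum-suc k φ ⟩
    wordSum k (φ ∘ (U ∷_)) + wordSum k (φ ∘ (D ∷_))       ≈⟨ +-cong
      (wordSum-zero k _ λ w → φ≈0 (U ∷ w) ∘ ≡.cong suc) (wordSum-zero k _ λ w → φ≈0 (D ∷ w) ∘ ≡.cong suc) ⟩
    0# + 0#                                               ≈⟨ +-identityʳ _ ⟩
    0# ∎

-- Power series of suffixes and their first-step equations.

module PathSeries {c ℓ} (R : CommutativeRing c ℓ) where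
  open PowerSeries R using (Series; _≋_; const; x; _+_; _*_; 0#; 1#; _^_)
  private
    module R = CommutativeRing R
    module A = CommutativeRing (SeriesRing.seriesRing R)
  open R using (_≈_; Carrier) renaming (_+_ to _⊕_; _*_ to _⊗_)
  open SeriesRing R hiding (*-cong)
  open WordSums R
  open import Algebra.Properties.Semiring.Exp R.semiring using () renaming (_^_ to _^ᴿ_)

  -- The suffixes starting at height c have c more down-steps than up-steps;
  -- x marks the up-steps.
  suffixes : ℕ → (List Step → Carrier) → Series
  suffixes c φ u = wordSum (c +ℕ 2 *ℕ u) φ

  suffixes-cong : ∀ c {φ ψ} → (∀ w → φ w ≈ ψ w) → suffixes c φ ≋ suffixes c ψ
  suffixes-cong c φ≈ψ u = listSum-cong φ≈ψ (words (c +ℕ 2 *ℕ u))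

  suffixes-* : ∀ c a φ → suffixes c (λ w → a ⊗ φ w) ≋ const a * suffixes c φ
  suffixes-* c a φ u = R.trans (listSum-* a φ (words (c +ℕ 2 *ℕ u))) (R.sym (const-* a (suffixes c φ) u))

  suffixes-+ : ∀ c φ ψ → suffixes c (λ w → φ w ⊕ ψ w) ≋ suffixes c φ + suffixes c ψ
  suffixes-+ c φ ψ u = listSum-+ φ ψ (words (c +ℕ 2 *ℕ u))

  suffixes-0 : ∀ c → suffixes c (λ _ → R.0#) ≋ 0#
  suffixes-0 c u = R.trans (wordSum-zero (c +ℕ 2 *ℕ u) _ λ _ _ → R.refl) (R.sym (0#-coefficient u))

  2*suc : ∀ c u → c +ℕ 2 *ℕ suc u ≡ suc (suc c) +ℕ 2 *ℕ u
  2*suc c u = ≡.trans (≡.cong (c +ℕ_) (ℕ.*-suc 2 u))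
    (≡.trans (ℕ.+-suc c (suc (2 *ℕ u))) (≡.cong suc (ℕ.+-suc c (2 *ℕ u))))

  -- A U followed by a suffix from height c + 2 accounts for the factor x. In the coefficient 0 the
  -- words starting with U have only c letters left, too few to descend from c + 2; `short` makes
  -- their weights vanish, as the factor x requires.
  suffixes-suc : ∀ c φ → (∀ w → length w < suc (suc c) → φ (U ∷ w) ≈ R.0#) →
    suffixes (suc c) φ ≋ x * suffixes (suc (suc c)) (φ ∘ (U ∷_)) + suffixes c (φ ∘ (D ∷_))
  suffixes-suc c φ short u = R.trans (wordSum-suc (c +ℕ 2 *ℕ u) φ) (R.+-congʳ (ups u))
    where
    ups : ∀ u → wordSum (c +ℕ 2 *ℕ u) (φ ∘ (U ∷_)) ≈ (x * suffixes (suc (suc c)) (φ ∘ (U ∷_))) u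
    ups zero    = R.trans
      (wordSum-zero (c +ℕ 0) _ λ w eq → short w (s≤s (ℕ.m≤n⇒m≤1+n (ℕ.≤-reflexive (≡.trans eq (ℕ.+-identityʳ c))))))
      (R.sym (x*-zero (suffixes (suc (suc c)) (φ ∘ (U ∷_)))))
    ups (suc u) = R.trans (R.reflexive (≡.cong (λ k → wordSum k (φ ∘ (U ∷_))) (2*suc c u)))
      (R.sym (x*-suc (suffixes (suc (suc c)) (φ ∘ (U ∷_))) u))

  suffixes-zero : ∀ φ → (∀ w → φ (D ∷ w) ≈ R.0#) →
    suffixes 0 φ ≋ const (φ []) + x * suffixes 1 (φ ∘ (U ∷_))
  suffixes-zero φ φD zero    = R.+-congˡ (R.sym (x*-zero (suffixes 1 (φ ∘ (U ∷_)))))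
  suffixes-zero φ φD (suc u) = begin
    wordSum (2 *ℕ suc u) φ
      ≡⟨ ≡.cong (λ k → wordSum k φ) (2*suc 0 u) ⟩
    wordSum (suc (suc (2 *ℕ u))) φ
      ≈⟨ wordSum-suc (suc (2 *ℕ u)) φ ⟩
    suffixes 1 (φ ∘ (U ∷_)) u ⊕ wordSum (suc (2 *ℕ u)) (φ ∘ (D ∷_))
      ≈⟨ R.+-congˡ (wordSum-zero (suc (2 *ℕ u)) _ λ w _ → φD w) ⟩
    suffixes 1 (φ ∘ (U ∷_)) u ⊕ R.0#
      ≈⟨ R.+-comm _ _ ⟩
    R.0# ⊕ suffixes 1 (φ ∘ (U ∷_)) u
      ≈⟨ R.+-congˡ (R.sym (x*-suc (suffixes 1 (φ ∘ (U ∷_))) u)) ⟩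
    (const (φ []) + x * suffixes 1 (φ ∘ (U ∷_))) (suc u) ∎
    where open SetoidReasoning R.setoid

  module _ (p q : Carrier) where
    open Weights R p q using (κ; ρ; σ; ρ-zero; σ-zero)
    open Strip (SeriesRing.seriesRing R) x (const p) (const q)
    open SetoidReasoning A.setoid

    κ≈α : ∀ c d → const (κ c d) ≋ α c d
    κ≈α c d = A.trans (const-homo-* (q ^ᴿ c) (p ^ᴿ d)) (A.*-cong (const-homo-^ q c) (const-homo-^ p d))

    suffixes-κ : ∀ c a d φ → suffixes c (λ w → κ a d ⊗ φ w) ≋ α a d * suffixes c φ
    suffixes-κ c a d φ = A.trans (suffixes-* c (κ a d) φ)
      (A.*-congʳ {suffixes c φ} {const (κ a d)} {α a d} (κ≈α a d))

    suffixes-U : ∀ c a d φ → x * suffixes c (λ w → κ a d ⊗ φ w) ≋ α a d * (x * suffixes c φ)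
    suffixes-U c a d φ = begin
      x * suffixes c (λ w → κ a d ⊗ φ w)
        ≈⟨ A.*-congˡ {x} {suffixes c (λ w → κ a d ⊗ φ w)} {α a d * suffixes c φ} (suffixes-κ c a d φ) ⟩
      x * (α a d * suffixes c φ)
        ≈⟨ A.*-assoc x (α a d) (suffixes c φ) ⟨
      x * α a d * suffixes c φ
        ≈⟨ A.*-congʳ {suffixes c φ} {x * α a d} {α a d * x} (A.*-comm x (α a d)) ⟩
      α a d * x * suffixes c φ
        ≈⟨ A.*-assoc (α a d) x (suffixes c φ) ⟩
      α a d * (x * suffixes c φ) ∎

    -- φ is the weight in a state at height 0, which no down-step can leave.
    suffixes-bottom : ∀ a d φ φᵁ → φ [] ≈ R.0# → (∀ w → φ (U ∷ w) ≈ κ a d ⊗ φᵁ w) →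
      (∀ w → φ (D ∷ w) ≈ R.0#) → suffixes 0 φ ≋ α a d * (x * suffixes 1 φᵁ)
    suffixes-bottom a d φ φᵁ φ[] φU φD = begin
      suffixes 0 φ
        ≈⟨ suffixes-zero φ φD ⟩
      const (φ []) + x * suffixes 1 (φ ∘ (U ∷_))
        ≈⟨ A.+-cong {const (φ [])} {0#} {x * suffixes 1 (φ ∘ (U ∷_))} {x * suffixes 1 (λ w → κ a d ⊗ φᵁ w)}
             (const-cong φ[]) (A.*-congˡ {x} {suffixes 1 (φ ∘ (U ∷_))} {suffixes 1 (λ w → κ a d ⊗ φᵁ w)}
               (suffixes-cong 1 φU)) ⟩
      0# + x * suffixes 1 (λ w → κ a d ⊗ φᵁ w)
        ≈⟨ A.+-identityˡ (x * suffixes 1 (λ w → κ a d ⊗ φᵁ w)) ⟩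
      x * suffixes 1 (λ w → κ a d ⊗ φᵁ w)
        ≈⟨ suffixes-U 1 a d φᵁ ⟩
      α a d * (x * suffixes 1 φᵁ) ∎

    suffixes-inner : ∀ c a d φ φᵁ φᴰ → (∀ w → φ (U ∷ w) ≈ κ a d ⊗ φᵁ w) → (∀ w → φ (D ∷ w) ≈ κ a d ⊗ φᴰ w) →
      (∀ w → length w < suc (suc c) → φᵁ w ≈ R.0#) →
      suffixes (suc c) φ ≋ α a d * (x * suffixes (suc (suc c)) φᵁ + suffixes c φᴰ)
    suffixes-inner c a d φ φᵁ φᴰ φU φD short = begin
      suffixes (suc c) φ
        ≈⟨ suffixes-suc c φ (λ w w< → R.trans (φU w) (R.trans (R.*-congˡ (short w w<)) (R.zeroʳ _))) ⟩
      x * suffixes c′ (φ ∘ (U ∷_)) + suffixes c (φ ∘ (D ∷_))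
        ≈⟨ A.+-cong {x * suffixes c′ (φ ∘ (U ∷_))} {x * suffixes c′ (λ w → κ a d ⊗ φᵁ w)}
             {suffixes c (φ ∘ (D ∷_))} {suffixes c (λ w → κ a d ⊗ φᴰ w)}
             (A.*-congˡ {x} {suffixes c′ (φ ∘ (U ∷_))} {suffixes c′ (λ w → κ a d ⊗ φᵁ w)} (suffixes-cong c′ φU))
             (suffixes-cong c φD) ⟩
      x * suffixes c′ (λ w → κ a d ⊗ φᵁ w) + suffixes c (λ w → κ a d ⊗ φᴰ w)
        ≈⟨ A.+-cong {x * suffixes c′ (λ w → κ a d ⊗ φᵁ w)} {α a d * (x * suffixes c′ φᵁ)}
             {suffixes c (λ w → κ a d ⊗ φᴰ w)} {α a d * suffixes c φᴰ}
             (suffixes-U c′ a d φᵁ) (suffixes-κ c a d φᴰ) ⟩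
      α a d * (x * suffixes c′ φᵁ) + α a d * suffixes c φᴰ
        ≈⟨ A.distribˡ (α a d) (x * suffixes c′ φᵁ) (suffixes c φᴰ) ⟨
      α a d * (x * suffixes c′ φᵁ + suffixes c φᴰ) ∎
      where c′ = suc (suc c)

    T : ℕ → ℕ → Series
    T zero    a = suffixes a λ w → ρ w a 0
    T (suc m) a = suffixes a λ w → σ w a 0 m

    ρ-short : ∀ c d w → length w < c → ρ w c d ≈ R.0#
    ρ-short c d w w<c = ρ-zero c d w λ f → ℕ.<⇒≱ w<c (dyckFrom⇒≤length (falling⇒dyck f))

    σ-short : ∀ c d m w → length w < c → σ w c d m ≈ R.0#
    σ-short c d m w w<c = σ-zero c d m w λ r → ℕ.<⇒≱ w<c (dyckFrom⇒≤length (rising⇒dyck r))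

    empty : T 0 0 ≋ 1#
    empty = A.trans (suffixes-zero (λ w → ρ w 0 0) (λ _ → R.refl))
      (A.trans (A.+-congˡ {1#} {x * suffixes 1 (λ _ → R.0#)} {0#}
          (A.trans (A.*-congˡ {x} {suffixes 1 (λ _ → R.0#)} {0#} (suffixes-0 1)) (A.zeroʳ x)))
        (A.+-identityʳ 1#))

    -- A falling suffix leaves level suc a downwards, by its last step from there, and continues as
    -- one with maximum a. At level 0 the path ends, which counts as leaving with weight 1.
    before : ℕ → Series
    before zero    = 1#
    before (suc a) = T 0 a

    falling : FirstStep (λ c d → suffixes c λ w → ρ w c d) before
    falling = record
      { bottom = λ d → suffixes-bottom 0 (suc d) (λ w → ρ w 0 (suc d)) (λ w → ρ w 1 d)
          R.refl (λ _ → R.refl) (λ _ → R.refl)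
      ; inner  = λ c d → suffixes-inner c (suc c) (suc d) (λ w → ρ w (suc c) (suc d))
          (λ w → ρ w (suc (suc c)) d) (λ w → ρ w c (suc (suc d)))
          (λ _ → R.refl) (λ _ → R.refl) (ρ-short (suc (suc c)) d)
      ; top₀   = A.trans empty (A.sym (A.trans (A.*-identityʳ (1# * 1#)) (A.*-identityʳ 1#)))
      ; top₊   = top₊
      }
      where
      top₊ : ∀ a → suffixes (suc a) (λ w → ρ w (suc a) 0) ≋
        α (suc a) 0 * (T 0 a + suffixes a (λ w → ρ w a 1))
      top₊ a = begin
        suffixes (suc a) (λ w → ρ w (suc a) 0)
          ≈⟨ suffixes-suc a (λ w → ρ w (suc a) 0) (λ _ _ → R.refl) ⟩
        x * suffixes (suc (suc a)) (λ _ → R.0#) + rest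
          ≈⟨ A.+-congʳ {rest} {x * suffixes (suc (suc a)) (λ _ → R.0#)} {0#}
               (A.trans (A.*-congˡ {x} {suffixes (suc (suc a)) (λ _ → R.0#)} {0#} (suffixes-0 (suc (suc a)))) (A.zeroʳ x)) ⟩
        0# + rest
          ≈⟨ A.+-identityˡ rest ⟩
        rest
          ≈⟨ suffixes-κ a (suc a) 0 (λ w → ρ w a 0 ⊕ ρ w a 1) ⟩
        α (suc a) 0 * suffixes a (λ w → ρ w a 0 ⊕ ρ w a 1)
          ≈⟨ A.*-congˡ {α (suc a) 0} {suffixes a (λ w → ρ w a 0 ⊕ ρ w a 1)} {T 0 a + suffixes a (λ w → ρ w a 1)}
               (suffixes-+ a (λ w → ρ w a 0) (λ w → ρ w a 1)) ⟩
        α (suc a) 0 * (T 0 a + suffixes a (λ w → ρ w a 1)) ∎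
        where rest = suffixes a (λ w → κ (suc a) 0 ⊗ (ρ w a 0 ⊕ ρ w a 1))

    -- A rising suffix leaves level a upwards, by the first step to suc a; this up-step brings the
    -- x.
    rising : ∀ m → FirstStep (λ c d → suffixes c λ w → σ w c d m) (λ a → x * T m (suc a))
    rising m = record
      { bottom = λ d → suffixes-bottom 0 (suc d) (λ w → σ w 0 (suc d) m) (λ w → σ w 1 d m)
          R.refl (λ _ → R.refl) (λ _ → R.refl)
      ; inner  = λ c d → suffixes-inner c (suc c) (suc d) (λ w → σ w (suc c) (suc d) m)
          (λ w → σ w (suc (suc c)) d m) (λ w → σ w c (suc (suc d)) m)
          (λ _ → R.refl) (λ _ → R.refl) (σ-short (suc (suc c)) d m)
      ; top₀   = top₀ m
      ; top₊   = top₊ m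
      }
      where
      top₀ : ∀ m → suffixes 0 (λ w → σ w 0 0 m) ≋ α 0 0 * (x * T m 1)
      top₀ zero    = suffixes-bottom 0 0 (λ w → σ w 0 0 0) (λ w → ρ w 1 0)
        R.refl (λ _ → R.refl) (λ _ → R.refl)
      top₀ (suc m) = suffixes-bottom 0 0 (λ w → σ w 0 0 (suc m)) (λ w → σ w 1 0 m)
        R.refl (λ _ → R.refl) (λ _ → R.refl)
      top₊ : ∀ m a → suffixes (suc a) (λ w → σ w (suc a) 0 m) ≋
        α (suc a) 0 * (x * T m (suc (suc a)) + suffixes a (λ w → σ w a 1 m))
      top₊ zero    a = suffixes-inner a (suc a) 0 (λ w → σ w (suc a) 0 0)
        (λ w → ρ w (suc (suc a)) 0) (λ w → σ w a 1 0)
        (λ _ → R.refl) (λ _ → R.refl) (ρ-short (suc (suc a)) 0)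
      top₊ (suc m) a = suffixes-inner a (suc a) 0 (λ w → σ w (suc a) 0 (suc m))
        (λ w → σ w (suc (suc a)) 0 m) (λ w → σ w a 1 (suc m))
        (λ _ → R.refl) (λ _ → R.refl) (σ-short (suc (suc a)) 0 m)

    levels : Levels T
    levels = record
      { empty = empty
      ; right = λ a → FirstStep.top falling (suc a)
      ; left  = λ m a → FirstStep.top (rising m) a
      }

-- The closed forms of the generating functions and their limit.

module GeneratingFunctions {c ℓ} (R : CommutativeRing c ℓ) where
  open PowerSeries R using (Series; _≋_; const; x; _+_; _*_; -_; 0#; 1#; _^_; _⁻¹; *-inverse; _/_; G≤; G; Converges;
    weight; pathSum; productFrom1; sumFrom1) renaming (sumTo to ∑)
  private
    module R = CommutativeRing R
    module A = CommutativeRing (SeriesRing.seriesRing R)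
    module AP = RingNotationProperties (SeriesRing.seriesRing R)
  open R using (_≈_; Carrier) renaming (_+_ to _⊕_; _*_ to _⊗_)
  open SeriesRing R hiding (*-cong)
  open WordSums R
  open PathSeries R
  open RingNotation R.rawRing using (sumTo)
  open RingNotationProperties R
  open import Algebra.Properties.Semiring.Exp R.semiring using () renaming (_^_ to _^ᴿ_)
  open import Algebra.Properties.Semiring.Exp A.semiring using (^-congˡ)

  ∑-coefficient : ∀ N (f : ℕ → Series) n → ∑ N f n ≈ sumTo N (λ h → f h n)
  ∑-coefficient zero    f n = R.+-congˡ (0#-coefficient n)
  ∑-coefficient (suc N) f n = R.+-congˡ (∑-coefficient N (f ∘ suc) n)

  module _ (p q : Carrier) where
    open Weights R p q using (τ; τ-dyck; τ-zero)

    -- Only the summand with h = height w can be nonzero, and only if w is a Dyck path; summing over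
    -- h thus replaces both filters in `G≤`.
    weight≤ : Carrier → ℕ → List Step → Carrier
    weight≤ y N w = sumTo N (λ h → y ^ᴿ h ⊗ τ h w)

    weight≤-in : ∀ y {N w} → Dyck w → height w ≤ N → weight≤ y N w ≈ weight y p q w
    weight≤-in y {N} {w} δ h≤N = R.trans
      (sumTo-single {N} {λ h → y ^ᴿ h ⊗ τ h w} (height w) h≤N
        λ i i≢h → R.trans (R.*-congˡ (τ-zero i w (i≢h ∘ ≡.sym ∘ proj₂))) (R.zeroʳ _))
      (R.trans (R.*-congˡ (τ-dyck δ ≡.refl)) (R.sym (R.*-assoc _ _ _)))

    weight≤-out : ∀ y {N w} → ¬ (Dyck w × height w ≤ N) → weight≤ y N w ≈ R.0#
    weight≤-out y {N} {w} out = sumTo-zero N (λ h → y ^ᴿ h ⊗ τ h w) λ h h≤N → R.trans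
      (R.*-congˡ (τ-zero h w λ { (δ , ≡.refl) → out (δ , h≤N) })) (R.zeroʳ _)

    G≤-sum : ∀ y N → G≤ N y p q ≋ ∑ N (λ h → const y ^ h * T p q h 0)
    G≤-sum y N n = begin
      G≤ N y p q n
        ≈⟨ listSum-filter (λ π → height π ℕ.≤? N) dyck? (weight≤-in y) (weight≤-out y) (words (2 *ℕ n)) ⟩
      listSum (weight≤ y N) (words (2 *ℕ n))
        ≈⟨ listSum-sumTo N (λ h w → y ^ᴿ h ⊗ τ h w) (words (2 *ℕ n)) ⟩
      sumTo N (λ h → listSum (λ w → y ^ᴿ h ⊗ τ h w) (words (2 *ℕ n)))
        ≈⟨ sumTo-cong N (λ h → listSum (λ w → y ^ᴿ h ⊗ τ h w) (words (2 *ℕ n))) (λ h → (const y ^ h * T p q h 0) n) coefficient ⟩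
      sumTo N (λ h → (const y ^ h * T p q h 0) n)
        ≈⟨ ∑-coefficient N (λ h → const y ^ h * T p q h 0) n ⟨
      ∑ N (λ h → const y ^ h * T p q h 0) n ∎
      where
      open SetoidReasoning R.setoid
      T≡ : ∀ h → T p q h 0 n ≡ listSum (τ h) (words (2 *ℕ n))
      T≡ zero    = ≡.refl
      T≡ (suc h) = ≡.refl
      coefficient : ∀ h → listSum (λ w → y ^ᴿ h ⊗ τ h w) (words (2 *ℕ n)) ≈ (const y ^ h * T p q h 0) n
      coefficient h = begin
        listSum (λ w → y ^ᴿ h ⊗ τ h w) (words (2 *ℕ n)) ≈⟨ listSum-* (y ^ᴿ h) (τ h) (words (2 *ℕ n)) ⟩
        y ^ᴿ h ⊗ listSum (τ h) (words (2 *ℕ n))         ≡⟨ ≡.cong (y ^ᴿ h ⊗_) (T≡ h) ⟨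
        y ^ᴿ h ⊗ T p q h 0 n                            ≈⟨ const-* (y ^ᴿ h) (T p q h 0) n ⟨
        (const (y ^ᴿ h) * T p q h 0) n                  ≈⟨ A.*-congʳ {T p q h 0} {const (y ^ᴿ h)} {const y ^ h} (const-homo-^ y h) n ⟩
        (const y ^ h * T p q h 0) n ∎

    private module S = Strip (SeriesRing.seriesRing R) x (const p) (const q)
    open S.Levels (levels p q)

    *-x-constant : ∀ f → (f * x) 0 ≈ R.0#
    *-x-constant f = R.trans (*-comm′ f x 0) (x*-zero f)

    -- Every correction in the recursion of `S` carries a factor x. So `_⁻¹`, an inverse only at
    -- constant term 1, may be applied to squares and products of continuants.
    S-constant : ∀ c j → S.S c j 0 ≈ R.1#
    S-constant zero          j = R.refl
    S-constant (suc zero)    j = R.refl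
    S-constant (suc (suc c)) j = begin
      S.S (suc c) (suc j) 0 ⊕ ((- e) * S.S c (suc (suc j))) 0
        ≈⟨ R.+-cong (S-constant (suc c) (suc j)) (R.trans (R.+-identityʳ _)
             (R.trans (R.*-congʳ (R.trans (R.-‿cong (*-x-constant (S.α (suc c) j * S.α c (suc j)))) -0≈0)) (R.zeroˡ _))) ⟩
      R.1# ⊕ R.0#
        ≈⟨ R.+-identityʳ _ ⟩
      R.1# ∎
      where
      open SetoidReasoning R.setoid
      open import Algebra.Properties.Ring R.ring using () renaming (-0#≈0# to -0≈0)
      e = S.α (suc c) j * S.α c (suc j) * x

    numerator-vanish : ∀ i i-inverse h → q ≈ R.0# → numerator i i-inverse (suc h) ≋ 0#
    numerator-vanish i i-inverse h q≈0 = A.trans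
      (A.*-congʳ {Π} {x ^ suc h * const q ^ (suc h *ℕ suc h)} {0#}
        (A.trans (A.*-congˡ {x ^ suc h} {const q ^ (suc h *ℕ suc h)} {0#} q^) (A.zeroʳ (x ^ suc h))))
      (A.zeroˡ Π)
      where
      Π = productFrom1 (suc h) (λ k → S.S k 1 ^ 2 * i k)
      const-q : const q ≋ 0#
      const-q = const-cong q≈0
      q^ : const q ^ (suc h *ℕ suc h) ≋ 0#
      q^ = A.trans (A.*-congʳ {const q ^ (h +ℕ h *ℕ suc h)} {const q} {0#} const-q) (A.zeroˡ (const q ^ (h +ℕ h *ℕ suc h)))

    square-inverse : ∀ k → S.S k 0 ^ 2 * (S.S k 0 ^ 2) ⁻¹ ≋ 1#
    square-inverse k = *-inverse (S.S k 0 ^ 2)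
      (constant-* (S.S k 0) (S.S k 0 * 1#) (S-constant k 0)
        (constant-* (S.S k 0) 1# (S-constant k 0) R.refl))

    -- The continuants are invertible series for every q, and the numerator has the factor q to the
    -- positive power (h + 1)².
    T-vanish : ∀ h → q ≈ R.0# → T p q (suc h) 0 ≋ 0#
    T-vanish h q≈0 = A.trans
      (T-formula i square-inverse (suc h) {d ⁻¹} (*-inverse d
        (constant-* (S.S (suc h) 1) (S.S (suc (suc h)) 0) (S-constant (suc h) 1) (S-constant (suc (suc h)) 0))))
      (A.trans (A.*-congʳ {d ⁻¹} {numerator i square-inverse (suc h)} {0#} (numerator-vanish i square-inverse h q≈0))
        (A.zeroˡ (d ⁻¹)))
      where
      i = λ k → (S.S k 0 ^ 2) ⁻¹
      d = S.S (suc h) 1 * S.S (suc (suc h)) 0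

  G≤-at-q≡0 : ∀ N y p → G≤ N y p R.0# ≋ 1#
  G≤-at-q≡0 N y p = A.trans (G≤-sum p R.0# y N) (A.trans
    (AP.sumTo-single {N} {λ h → const y ^ h * T p R.0# h 0} 0 z≤n
      (λ { zero 0≢0 → λ _ → ⊥-elim (0≢0 ≡.refl)
         ; (suc h) _ → A.trans (A.*-congˡ {const y ^ suc h} {T p R.0# (suc h) 0} {0#} (T-vanish p R.0# h R.refl))
             (A.zeroʳ (const y ^ suc h)) }))
    (A.trans (A.*-identityˡ (T p R.0# 0 0)) (empty p R.0#)))

  module _ (q : Carrier) where
    private module S = Strip (SeriesRing.seriesRing R) x 0# (const q)
    open S.Levels (levels R.0# q) using (T-formula; numerator)
    open SetoidReasoning A.setoid

    -- Of two neighbouring states of a strip the lower one has depth at least 1, so every correction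
    -- contains a positive power of p = 0. All gap enumerators become 1, and only the marked steps
    -- contribute.
    S≈1 : ∀ c j → S.S c j ≋ 1#
    S≈1 zero          j = A.refl {1#}
    S≈1 (suc zero)    j = A.refl {1#}
    S≈1 (suc (suc c)) j = begin
      S.S (suc c) (suc j) + (- e) * s
        ≈⟨ A.+-cong {S.S (suc c) (suc j)} {1#} {(- e) * s} {0# * s} (S≈1 (suc c) (suc j))
             (A.*-congʳ {s} { - e} {0#} (A.trans (A.-‿cong {e} {0#} e≈0) -0≈0)) ⟩
      1# + 0# * s
        ≈⟨ A.+-congˡ {1#} {0# * s} {0#} (A.zeroˡ s) ⟩
      1# + 0#
        ≈⟨ A.+-identityʳ 1# ⟩
      1# ∎
      where
      open import Algebra.Properties.Ring A.ring using () renaming (-0#≈0# to -0≈0)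
      s = S.S c (suc (suc j))
      a = S.α (suc c) j
      e = a * S.α c (suc j) * x
      α≈0 : S.α c (suc j) ≋ 0#
      α≈0 = A.trans (A.*-congˡ {const q ^ c} {0# ^ suc j} {0#} (AP.zero^suc j)) (A.zeroʳ (const q ^ c))
      e≈0 : e ≋ 0#
      e≈0 = A.trans (A.*-congʳ {x} {a * S.α c (suc j)} {0#}
        (A.trans (A.*-congˡ {a} {S.α c (suc j)} {0#} α≈0) (A.zeroʳ a))) (A.zeroˡ x)

    square≈1 : ∀ k j → S.S k j ^ 2 * 1# ≋ 1#
    square≈1 k j = A.trans (A.*-identityʳ (S.S k j ^ 2)) (A.trans (^-congˡ 2 {S.S k j} {1#} (S≈1 k j)) (AP.one^ 2))

    product≈1 : ∀ h → productFrom1 h (λ k → S.S k 1 ^ 2 * 1#) ≋ 1#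
    product≈1 zero    = A.refl {1#}
    product≈1 (suc h) = A.trans (AP.productFrom1-suc h (λ k → S.S k 1 ^ 2 * 1#))
      (A.trans (A.*-cong {productFrom1 h (λ k → S.S k 1 ^ 2 * 1#)} {1#} {S.S (suc h) 1 ^ 2 * 1#} {1#}
          (product≈1 h) (square≈1 (suc h) 1))
        (A.*-identityˡ 1#))

    T-at-p≡0 : ∀ h → T R.0# q h 0 ≋ x ^ h * const q ^ (h *ℕ h)
    T-at-p≡0 h = begin
      T R.0# q h 0
        ≈⟨ T-formula (λ _ → 1#) (λ k → square≈1 k 0) h {1#}
             (A.trans (A.*-identityʳ (S.S h 1 * S.S (suc h) 0))
               (A.trans (A.*-cong {S.S h 1} {1#} {S.S (suc h) 0} {1#} (S≈1 h 1) (S≈1 (suc h) 0)) (A.*-identityˡ 1#))) ⟩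
      xq * Π * 1#
        ≈⟨ A.*-identityʳ (xq * Π) ⟩
      xq * Π
        ≈⟨ A.*-congˡ {xq} {Π} {1#} (product≈1 h) ⟩
      xq * 1#
        ≈⟨ A.*-identityʳ xq ⟩
      xq ∎
      where
      xq = x ^ h * const q ^ (h *ℕ h)
      Π  = productFrom1 h (λ k → S.S k 1 ^ 2 * 1#)

    G≤-at-p≡0 : ∀ N y → G≤ N y R.0# q ≋ 1# + sumFrom1 N (λ h → (x * const y) ^ h * const q ^ (h *ℕ h))
    G≤-at-p≡0 N y = A.trans (G≤-sum R.0# q y N) (A.trans
      (AP.sumTo-cong N (λ h → const y ^ h * T R.0# q h 0) (λ h → (x * const y) ^ h * const q ^ (h *ℕ h)) summand)
      (A.+-congʳ {sumFrom1 N (λ h → (x * const y) ^ h * const q ^ (h *ℕ h))} {1# * 1#} {1#} (A.*-identityˡ 1#)))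
      where
      summand : ∀ h → const y ^ h * T R.0# q h 0 ≋ (x * const y) ^ h * const q ^ (h *ℕ h)
      summand h = begin
        yh * T R.0# q h 0            ≈⟨ A.*-congˡ {yh} {T R.0# q h 0} {xh * qh} (T-at-p≡0 h) ⟩
        yh * (xh * qh)               ≈⟨ A.*-assoc yh xh qh ⟨
        yh * xh * qh                 ≈⟨ A.*-congʳ {qh} {yh * xh} {xh * yh} (A.*-comm yh xh) ⟩
        xh * yh * qh                 ≈⟨ A.*-congʳ {qh} {xh * yh} {(x * const y) ^ h} (A.sym {(x * const y) ^ h} {xh * yh} (AP.^-distrib-* x (const y) h)) ⟩
        (x * const y) ^ h * qh ∎
        where
        yh = const y ^ h
        xh = x ^ h
        qh = const q ^ (h *ℕ h)

  -- A path with 2 n steps cannot rise above 2 n, so from N = 2 n on the height filter keeps every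
  -- path.
  G≤-converges : ∀ y p q → Converges (λ N → G≤ N y p q) (G y p q)
  G≤-converges y p q n = 2 *ℕ n , λ N 2n≤N → R.reflexive (≡.cong (pathSum y p q) (filter-all (λ π → height π ℕ.≤? N)
    (All.filter⁺ dyck? (All.map (λ {w} eq → ℕ.≤-trans (top≤start+length 0 w) (ℕ.≤-trans (ℕ.≤-reflexive eq) 2n≤N))
      (words-length (2 *ℕ n))))))

  module _ (p q : Carrier) where
    private module S = Strip (SeriesRing.seriesRing R) x (const p) (const q)
    open S.Levels (levels p q) using (T-formula)

    module _ {a b b⁺ : ℕ → Series} (S≈a : ∀ k → S.S k 1 ≋ a k) (S≈b : ∀ k → S.S k 0 ≋ b k)
      (S≈b⁺ : ∀ k → S.S (suc k) 0 ≋ b⁺ k) where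
      open SetoidReasoning A.setoid

      -- The inverse is formed from `b k`, the expression standing in the formula, and then shown to
      -- invert the square of S k 0; in this way the quotients come out literally as stated.
      i : ℕ → Series
      i k = (b k ^ 2) ⁻¹

      i-inverse : ∀ k → S.S k 0 ^ 2 * i k ≋ 1#
      i-inverse k = A.trans
        (A.*-congʳ {i k} {S.S k 0 ^ 2} {b k ^ 2} (^-congˡ 2 {S.S k 0} {b k} (S≈b k)))
        (*-inverse (b k ^ 2) (constant-* (b k) (b k * 1#) b≈1 (constant-* (b k) 1# b≈1 R.refl)))
        where
        b≈1 : b k 0 ≈ R.1#
        b≈1 = R.trans (R.sym (S≈b k 0)) (S-constant p q k 0)

      denominator-inverse : ∀ h → S.S h 1 * S.S (suc h) 0 * (a h * b⁺ h) ⁻¹ ≋ 1#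
      denominator-inverse h = A.trans
        (A.*-congʳ {(a h * b⁺ h) ⁻¹} {S.S h 1 * S.S (suc h) 0} {a h * b⁺ h} S*S≈)
        (*-inverse (a h * b⁺ h) (R.trans (R.sym (S*S≈ 0))
          (constant-* (S.S h 1) (S.S (suc h) 0) (S-constant p q h 1) (S-constant p q (suc h) 0))))
        where
        S*S≈ : S.S h 1 * S.S (suc h) 0 ≋ a h * b⁺ h
        S*S≈ = A.*-cong {S.S h 1} {a h} {S.S (suc h) 0} {b⁺ h} (S≈a h) (S≈b⁺ h)

      G≤-quotient : ∀ y N → G≤ N y p q ≋ ∑ N (λ h →
        (x ^ h * const y ^ h * const q ^ (h *ℕ h) * productFrom1 h (λ k → a k ^ 2 / b k ^ 2)) / (a h * b⁺ h))
      G≤-quotient y N = A.trans (G≤-sum p q y N) (AP.sumTo-cong N (λ h → const y ^ h * T p q h 0) _ summand)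
        where
        summand : ∀ h → const y ^ h * T p q h 0 ≋
          (x ^ h * const y ^ h * const q ^ (h *ℕ h) * productFrom1 h (λ k → a k ^ 2 / b k ^ 2)) / (a h * b⁺ h)
        summand h = begin
          yh * T p q h 0
            ≈⟨ A.*-congˡ {yh} {T p q h 0} {xh * qh * Π * j} (T-formula i i-inverse h {j} (denominator-inverse h)) ⟩
          yh * (xh * qh * Π * j)
            ≈⟨ A.*-assoc yh (xh * qh * Π) j ⟨
          yh * (xh * qh * Π) * j
            ≈⟨ A.*-congʳ {j} {yh * (xh * qh * Π)} {xh * yh * qh * Π′} numerators ⟩
          xh * yh * qh * Π′ * j ∎
          where
          yh = const y ^ h
          xh = x ^ h
          qh = const q ^ (h *ℕ h)
          j  = (a h * b⁺ h) ⁻¹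
          Π  = productFrom1 h (λ k → S.S k 1 ^ 2 * i k)
          Π′ = productFrom1 h (λ k → a k ^ 2 / b k ^ 2)
          Π≈Π′ : Π ≋ Π′
          Π≈Π′ = AP.productFrom1-cong h (λ k → S.S k 1 ^ 2 * i k) (λ k → a k ^ 2 / b k ^ 2)
            λ k → A.*-congʳ {i (suc k)} {S.S (suc k) 1 ^ 2} {a (suc k) ^ 2} (^-congˡ 2 {S.S (suc k) 1} {a (suc k)} (S≈a (suc k)))
          numerators : yh * (xh * qh * Π) ≋ xh * yh * qh * Π′
          numerators = begin
            yh * (xh * qh * Π)   ≈⟨ A.*-assoc yh (xh * qh) Π ⟨
            yh * (xh * qh) * Π   ≈⟨ A.*-cong {yh * (xh * qh)} {xh * yh * qh} {Π} {Π′}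
              (A.trans (A.sym {yh * xh * qh} {yh * (xh * qh)} (A.*-assoc yh xh qh))
                (A.*-congʳ {qh} {yh * xh} {xh * yh} (A.*-comm yh xh))) Π≈Π′ ⟩
            xh * yh * qh * Π′ ∎

proposition4p2 :
  ∀ {c ℓ} (R : CommutativeRing c ℓ) →
  let open PowerSeries R in
  (∀ (y p q q⁻¹ : Carrier) → q *ᴿ q⁻¹ ≈ 1ᴿ → ∀ (N : ℕ) →
    let Y = const y
        p₁ = const p
        q^ = λ e → zpow (const q) (const q⁻¹) e
        Q = p₁ ^ 2 * const q⁻¹ ^ 2
    in
    G≤ N y p q ≋
      (∑[0≤ h ≤ N ]
        ((x ^ h * Y ^ h * const q ^ (h *ℕ h)
           * (∏[1≤ k ≤ h ] (P k (q^ (2 *ℕ k ⊖ 3) * p₁ ^ 3 * x) Q ^ 2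
                             / P k (q^ (2 *ℕ k ⊖ 3) * p₁ * x) Q ^ 2)))
          / (P h (q^ (2 *ℕ h ⊖ 3) * p₁ ^ 3 * x) Q
              * P (suc h) (q^ (2 *ℕ h ⊖ 1) * p₁ * x) Q))))
  × (∀ (N : ℕ) (y p : Carrier) → G≤ N y p 0ᴿ ≋ 1#)
  × (∀ (N : ℕ) (y q : Carrier) →
      G≤ N y 0ᴿ q ≋ 1# + (∑[1≤ h ≤ N ] ((x * const y) ^ h * const q ^ (h *ℕ h))))
  × (∀ (y p q : Carrier) → Converges (λ N → G≤ N y p q) (G y p q))
proposition4p2 R =
    (λ y p q q⁻¹ q*q⁻¹≈1 N →
      let open PowerSeries R
          open SeriesRing R using (seriesRing; const-inverse)
          open StripPolynomials seriesRing x (const p) (const q) (const q⁻¹) (const-inverse q*q⁻¹≈1)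
            using (S≈P₁; S≈P₀; S≈P₀-suc)
          Q = const p ^ 2 * const q⁻¹ ^ 2
      in G≤-quotient p q
           {λ k → P k (zpow (const q) (const q⁻¹) (2 *ℕ k ⊖ 3) * const p ^ 3 * x) Q}
           {λ k → P k (zpow (const q) (const q⁻¹) (2 *ℕ k ⊖ 3) * const p * x) Q}
           {λ k → P (suc k) (zpow (const q) (const q⁻¹) (2 *ℕ k ⊖ 1) * const p * x) Q}
           S≈P₁ S≈P₀ S≈P₀-suc y N)
  , G≤-at-q≡0
  , (λ N y q → G≤-at-p≡0 q N y)
  , G≤-converges
  where open GeneratingFunctions R
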